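{- There is an absolute constant $\alpha$ such that the following holds. Let $H$ be a graph on $r\ge 3$ vertices, $\varepsilon\in(0,1/2]$, and $\ell=\alpha r^3+\lceil\varepsilon^{ -20}\rceil$. If $G$ (with maximum degree $d$) is $H$-minor-free, then the algorithm IsMinorFree$(G,\varepsilon,H)$ outputs ACCEPT with probability at least $2/3$.
   Context: $G=(V,E)$, $|V|=n$, maximum degree $d$, accessed by neighbor queries. The lazy random walk: from vertex $v$ of degree $d_v$, move to each neighbor with probability $1/(2d)$ and stay at $v$ with probability $1-d_v/(2d)$. Algorithm IsMinorFree$(G,\varepsilon,H)$: (1) pick a multiset $S$ of $\ell^{21}$ uniformly random vertices; (2) for every $s\in S$ run EstClip$(s)$ and LocalSearch$(s)$; (3) if any call to LocalSearch returns FOUND, REJECT; (4) if more than $2\ell^{20}$ calls to EstClip return LOW, REJECT; (5) otherwise ACCEPT. LocalSearch$(s)$: perform $\ell^{21}$ independent lazy random walks of length $\ell^{11}$ from $s$, let $B_s$ be the set of all vertices encountered, determine the induced subgraph $G[B_s]$, and return FOUND iff $G[B_s]$ contains an $H$-minor (decided by an exact minor-finding algorithm). EstClip$(s)$: perform $w=\ell^{14}$ independent lazy random walks of length $\ell$ from $s$; for every vertex $v$ let $w_v$ be the number of walks ending at $v$; let $T=\{v: w_v\ge \ell^7/2\}$; output HIGH if $\sum_{v\in T}w_v\ge w/3$, else LOW.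
   Formalization: The parameter ε ranges over the rational numbers in (0,1/2] instead of the real ones; since ε enters only through ⌈ε^{ -20}⌉, every value of ℓ that a real ε gives is still covered. -}

module Defs where

open import Level using (Level; _⊔_) renaming (suc to lsuc; zero to lzero)
open import Data.Bool using (Bool; true; false; if_then_else_)
open import Data.Nat as ℕ using (ℕ; zero; suc; _^_; _≤ᵇ_; NonZero)
open import Data.Integer as ℤ using (+_)
open import Data.Rational as ℚ using (ℚ; 0ℚ; 1ℚ; ½; _/_; 1/_; ceiling)
open import Data.Fin as Fin using (Fin)
open import Data.Fin.Properties using () renaming (_≟_ to _≟ᶠ_)
open import Data.List using (List; []; _∷_; map; concatMap; concat; filterᵇ; length; foldr)
open import Data.Nat.ListAction using (sum)
open import Data.List.Membership.Propositional using (_∈_)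
open import Data.List.Relation.Unary.All using (All)
open import Data.Product using (Σ; ∃; ∃-syntax; _×_; _,_; proj₁; proj₂)
open import Data.Unit using (⊤)
open import Relation.Nullary using (¬_; does)
open import Relation.Binary.PropositionalEquality using (_≡_)

private variable
  a b p : Level
  A B : Set a

record Graph (n : ℕ) : Set where
  field
    adj    : Fin n → Fin n → Bool
    sym    : ∀ u v → adj u v ≡ adj v u
    irrefl : ∀ v → adj v v ≡ false
open Graph public

allVertices : (n : ℕ) → List (Fin n)
allVertices n = Data.List.allFin n
  where import Data.List

neighbours : ∀ {n} → Graph n → Fin n → List (Fin n)
neighbours G v = filterᵇ (adj G v) (allVertices n)
  where n = _

degree : ∀ {n} → Graph n → Fin n → ℕ
degree G v = length (neighbours G v)

MaxDegree≤ : ∀ {n} → Graph n → ℕ → Set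
MaxDegree≤ {n} G d = ∀ (v : Fin n) → degree G v ℕ.≤ d

data PathIn {n} (G : Graph n) (P : Fin n → Set) : Fin n → Fin n → Set where
  here : ∀ {x} → P x → PathIn G P x x
  step : ∀ {x z y} → P x → adj G x z ≡ true → PathIn G P z y → PathIn G P x y

HasMinorIn : ∀ {n r} → Graph n → (Fin n → Set) → Graph r → Set₁
HasMinorIn {n} {r} G X H =
  Σ (Fin r → Fin n → Set) λ β →
      (∀ u v → β u v → X v)
    × (∀ u → ∃[ v ] β u v)
    × (∀ u x y → β u x → β u y → PathIn G (β u) x y)
    × (∀ u u' v → β u v → β u' v → u ≡ u')
    × (∀ u u' → adj H u u' ≡ true →
         ∃[ x ] ∃[ y ] (β u x × β u' y × adj G x y ≡ true))

HasMinor : ∀ {n r} → Graph n → Graph r → Set₁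
HasMinor G H = HasMinorIn G (λ _ → ⊤) H

MinorFree : ∀ {n r} → Graph n → Graph r → Set₁
MinorFree G H = ¬ HasMinor G H

Dist : Set a → Set a
Dist A = List (ℚ × A)

pureD : A → Dist A
pureD x = (1ℚ , x) ∷ []

bindD : Dist A → (A → Dist B) → Dist B
bindD d f = concatMap (λ { (p , x) → map (λ { (q , y) → (p ℚ.* q , y) }) (f x) }) d

replicateD : ℕ → Dist A → Dist (List A)
replicateD zero    d = pureD []
replicateD (suc k) d = bindD d λ x → bindD (replicateD k d) λ xs → pureD (x ∷ xs)

mapD : (A → Dist B) → List A → Dist (List B)
mapD f []       = pureD []
mapD f (x ∷ xs) = bindD (f x) λ y → bindD (mapD f xs) λ ys → pureD (y ∷ ys)

uniform : (n : ℕ) → .{{NonZero n}} → Dist (Fin n)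
uniform n = map (λ i → ((+ 1) / n , i)) (allVertices n)

weightOf : Dist A → (A → Bool) → ℚ
weightOf d f = foldr (λ { (p , x) acc → if f x then p ℚ.+ acc else acc }) 0ℚ d

-- Pr_{x ~ D}[ P x ] ≥ q  (the event P contains a (decidable) sub-event of
-- probability at least q)
PrAtLeast : Dist A → (A → Set p) → ℚ → Set _
PrAtLeast {A = A} D P q =
  Σ (A → Bool) λ f → (∀ x → f x ≡ true → P x) × (q ℚ.≤ weightOf D f)

module Walk {n : ℕ} (G : Graph n) (d : ℕ) .{{_ : NonZero d}} where

  moveP : ℚ
  moveP = ((+ 1) / d) ℚ.* ½

  lazyStep : Fin n → Dist (Fin n)
  lazyStep v = (1ℚ ℚ.- ((+ degree G v) / d) ℚ.* ½ , v)
             ∷ map (λ u → (moveP , u)) (neighbours G v)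

  walkEnd : ℕ → Fin n → Dist (Fin n)
  walkEnd zero    v = pureD v
  walkEnd (suc L) v = bindD (lazyStep v) (walkEnd L)

  walk : ℕ → Fin n → Dist (List (Fin n))
  walk zero    v = pureD (v ∷ [])
  walk (suc L) v = bindD (lazyStep v) λ u → bindD (walk L u) λ t → pureD (v ∷ t)

  module Alg (ℓ : ℕ) where

    countIn : List (Fin n) → Fin n → ℕ
    countIn xs v = length (filterᵇ (λ u → does (u ≟ᶠ v)) xs)

    -- HIGH = true, LOW = false
    clipDecision : List (Fin n) → Bool
    clipDecision ends =
      let w  = ℓ ^ 14
          wv = countIn ends
          -- v ∈ T  iff  w_v ≥ ℓ^7 / 2  iff  ℓ^7 ≤ 2 w_v
          sT = sum (map (λ v → if (ℓ ^ 7) ≤ᵇ (2 ℕ.* wv v) then wv v else 0)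
                        (allVertices n))
      in  w ≤ᵇ (3 ℕ.* sT)

    EstClip : Fin n → Dist Bool
    EstClip s = bindD (replicateD (ℓ ^ 14) (walkEnd ℓ s)) λ ends →
                pureD (clipDecision ends)

    -- outcome: the list of all encountered vertices (the set B_s)
    LocalSearchWalks : Fin n → Dist (List (Fin n))
    LocalSearchWalks s = bindD (replicateD (ℓ ^ 21) (walk (ℓ ^ 11) s)) λ ts →
                         pureD (concat ts)

    perVertex : Fin n → Dist (Bool × List (Fin n))
    perVertex s = bindD (EstClip s) λ h → bindD (LocalSearchWalks s) λ B →
                  pureD (h , B)

    IsMinorFreeRun : .{{NonZero n}} → Dist (List (Bool × List (Fin n)))
    IsMinorFreeRun = bindD (replicateD (ℓ ^ 21) (uniform n)) λ S →
                     mapD perVertex S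

    countLow : List (Bool × List (Fin n)) → ℕ
    countLow xs = length (filterᵇ (λ x → if proj₁ x then false else true) xs)

    -- the run outputs ACCEPT: no LocalSearch returns FOUND (no G[B_s]
    -- contains an H-minor) and at most 2ℓ^20 EstClip calls return LOW
    Accepts : ∀ {r} → Graph r → List (Bool × List (Fin n)) → Set₁
    Accepts H xs =
        All (λ x → ¬ HasMinorIn G (λ v → v ∈ proj₂ x) H) xs
      × countLow xs ℕ.≤ 2 ℕ.* (ℓ ^ 20)

powℚ : ℚ → ℕ → ℚ
powℚ q zero    = 1ℚ
powℚ q (suc k) = q ℚ.* powℚ q k

ellParam : (α r : ℕ) (ε : ℚ) → 0ℚ ℚ.< ε → ℕ
ellParam α r ε ε>0 =
  α ℕ.* r ^ 3 ℕ.+ ℤ.∣ ceiling (powℚ ((1/ ε) {{ℚ.>-nonZero ε>0}}) 20) ∣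

module Submission where

-- Since G is H-minor-free, no LocalSearch returns FOUND, so only the LOW answers matter.
-- G has no r disjoint, connected, pairwise adjacent vertex sets; Alon–Seymour–Thomas
-- separators, applied at geometrically growing scales, then give a set R with
-- 3ℓ(ℓ + 1)|R| ≤ n such that the components of G − R have at most ℓ⁶ vertices.
-- If EstClip(s) is LOW, at least half of its w = ℓ¹⁴ walks end outside the component C of s,
-- because the vertices of C that miss the threshold receive fewer than |C|ℓ⁷/2 ≤ w/6 walks.
-- A walk leaving C hits R, and the uniform distribution is stationary, so from a uniform
-- start this has probability at most (ℓ + 1)|R|/n. Hence LOW has probability at most 2/(3ℓ)
-- by Markov's inequality, and more than 2ℓ²⁰ LOW answers have probability at most 1/3.

-- A set of at most 2N vertices falls into pieces of at most N vertices after the deletion of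
-- O(r²√N) vertices, a fraction of order r²/√N. These fractions double each time N shrinks by a
-- factor of four, so the smallest scale dominates and their sum does not depend on n. Deleting
-- vertices instead of edges keeps d out of the bound on R. The walk keeps it out as well: every
-- edge is crossed with probability 1/(2d) in either direction, whatever the degrees, so the
-- transition matrix is symmetric and the uniform distribution is stationary. The probabilistic half
-- uses first moments only. Markov's inequality is applied twice, once to the escaping walks from a
-- fixed start and once to the number of LOW answers, so linearity of expectation replaces any
-- concentration bound.

open import Defs

module Hyperfiniteness where

  open import Data.Bool using (true) renaming (_≟_ to _≟ᵇ_)
  open import Data.Nat as ℕ using (ℕ; zero; suc; _+_; _*_; _^_; _≤_; _<_; z≤n; s≤s)
  open import Data.Nat.Properties hiding (_≟_)
  open import Algebra.Properties.Semiring.Sum +-*-semiring using (∑-distrib-+) renaming (sum to ∑)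
  open import Data.Fin using (Fin; zero; suc; inject₁; fromℕ; toℕ; punchIn; punchOut)
  open import Data.Fin.Properties using (_≟_; any?; all?; ¬∀⟶∃¬; toℕ-inject₁; toℕ-fromℕ; toℕ<n; toℕ-injective; punchIn-injective; punchInᵢ≢i; punchIn-punchOut)
  open import Data.Fin.Induction using (<-weakInduction)
  open import Data.Fin.Subset
  open import Data.Fin.Subset.Properties
  open import Data.Vec using ([]; _∷_; tabulate; here; there)
  open import Data.Vec.Functional using () renaming (_∷_ to _∷ᵛ_)
  open import Data.Vec.Properties using (lookup∘tabulate; lookup⇒[]=; []=⇒lookup)
  open import Data.Product using (∃; _×_; _,_; proj₁; proj₂)
  open import Data.Sum using (_⊎_; inj₁; inj₂; [_,_]′)
  open import Data.Unit using (tt)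
  open import Function using (_∘_; id)
  open import Relation.Nullary using (¬_; yes; no; does; contradiction)
  open import Relation.Nullary.Decidable using (dec-true; _×-dec_; decidable-stable)
  open import Relation.Unary using (Decidable)
  open import Relation.Binary.PropositionalEquality using (_≡_; _≢_; refl; cong; cong₂; subst; trans) renaming (sym to ≡-sym)
  open import Data.Nat.Tactic.RingSolver using (solve-∀)

  private variable
    n k : ℕ

  -- Finite subsets and their cardinalities

  subsetOf : {P : Fin n → Set} → Decidable P → Subset n
  subsetOf P? = tabulate (does ∘ P?)

  ∈-subsetOf⁺ : {P : Fin n → Set} (P? : Decidable P) {x : Fin n} → P x → x ∈ subsetOf P?
  ∈-subsetOf⁺ P? {x} px = lookup⇒[]= x _ (trans (lookup∘tabulate (does ∘ P?) x) (dec-true (P? x) px))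

  ∈-subsetOf⁻ : {P : Fin n → Set} (P? : Decidable P) {x : Fin n} → x ∈ subsetOf P? → P x
  ∈-subsetOf⁻ P? {x} x∈ with P? x | trans (≡-sym (lookup∘tabulate (does ∘ P?) x)) ([]=⇒lookup x∈)
  ... | yes px | _ = px
  ... | no _   | ()

  x∈p─q⇒x∉q : (p q : Subset n) {x : Fin n} → x ∈ p ─ q → x ∉ q
  x∈p─q⇒x∉q (_ ∷ p) (outside ∷ q) here ()
  x∈p─q⇒x∉q (_ ∷ p) (inside  ∷ q) (there x∈) (there x∈q) = x∈p─q⇒x∉q p q x∈ x∈q
  x∈p─q⇒x∉q (_ ∷ p) (outside ∷ q) (there x∈) (there x∈q) = x∈p─q⇒x∉q p q x∈ x∈q

  ∈─⁻ : (p q : Subset n) {x : Fin n} → x ∈ p ─ q → x ∈ p × x ∉ q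
  ∈─⁻ p q x∈ = p─q⊆p p q x∈ , x∈p─q⇒x∉q p q x∈

  ∣p∪q∣≤∣p∣+∣q∣ : (p q : Subset n) → ∣ p ∪ q ∣ ≤ ∣ p ∣ + ∣ q ∣
  ∣p∪q∣≤∣p∣+∣q∣ [] [] = z≤n
  ∣p∪q∣≤∣p∣+∣q∣ (outside ∷ p) (outside ∷ q) = ∣p∪q∣≤∣p∣+∣q∣ p q
  ∣p∪q∣≤∣p∣+∣q∣ (outside ∷ p) (inside  ∷ q) = ≤-trans (s≤s (∣p∪q∣≤∣p∣+∣q∣ p q)) (≤-reflexive (≡-sym (+-suc ∣ p ∣ ∣ q ∣)))
  ∣p∪q∣≤∣p∣+∣q∣ (inside  ∷ p) (outside ∷ q) = s≤s (∣p∪q∣≤∣p∣+∣q∣ p q)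
  ∣p∪q∣≤∣p∣+∣q∣ (inside  ∷ p) (inside  ∷ q) = s≤s (≤-trans (∣p∪q∣≤∣p∣+∣q∣ p q) (+-monoʳ-≤ ∣ p ∣ (n≤1+n ∣ q ∣)))

  ∣q∣+∣p─q∣≤∣p∣ : {p q : Subset n} → q ⊆ p → ∣ q ∣ + ∣ p ─ q ∣ ≤ ∣ p ∣
  ∣q∣+∣p─q∣≤∣p∣ {p = []} {[]} q⊆p = z≤n
  ∣q∣+∣p─q∣≤∣p∣ {p = outside ∷ p} {outside ∷ q} q⊆p = ∣q∣+∣p─q∣≤∣p∣ (drop-∷-⊆ q⊆p)
  ∣q∣+∣p─q∣≤∣p∣ {p = inside  ∷ p} {outside ∷ q} q⊆p = ≤-trans (≤-reflexive (+-suc ∣ q ∣ ∣ p ─ q ∣)) (s≤s (∣q∣+∣p─q∣≤∣p∣ (drop-∷-⊆ q⊆p)))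
  ∣q∣+∣p─q∣≤∣p∣ {p = inside  ∷ p} {inside  ∷ q} q⊆p = s≤s (∣q∣+∣p─q∣≤∣p∣ (drop-∷-⊆ q⊆p))
  ∣q∣+∣p─q∣≤∣p∣ {p = outside ∷ p} {inside  ∷ q} q⊆p with q⊆p here
  ... | ()

  ⋃ᶠ : (Fin k → Subset n) → Subset n
  ⋃ᶠ {k = zero}  X = ⊥
  ⋃ᶠ {k = suc k} X = X zero ∪ ⋃ᶠ (X ∘ suc)

  ∈⋃ᶠ : (X : Fin k → Subset n) (i : Fin k) → X i ⊆ ⋃ᶠ X
  ∈⋃ᶠ X zero    = x∈p∪q⁺ ∘ inj₁
  ∈⋃ᶠ X (suc i) = x∈p∪q⁺ ∘ inj₂ ∘ ∈⋃ᶠ (X ∘ suc) i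

  ∣⋃ᶠ∣≤∑ : (X : Fin k → Subset n) → ∣ ⋃ᶠ X ∣ ≤ ∑ (λ i → ∣ X i ∣)
  ∣⋃ᶠ∣≤∑ {k = zero} {n} X = ≤-reflexive (∣⊥∣≡0 n)
  ∣⋃ᶠ∣≤∑ {k = suc k} X = ≤-trans (∣p∪q∣≤∣p∣+∣q∣ (X zero) _) (+-monoʳ-≤ ∣ X zero ∣ (∣⋃ᶠ∣≤∑ (X ∘ suc)))

  ∑-mono : {f g : Fin k → ℕ} → (∀ i → f i ≤ g i) → ∑ f ≤ ∑ g
  ∑-mono {k = zero}  f≤g = z≤n
  ∑-mono {k = suc k} f≤g = +-mono-≤ (f≤g zero) (∑-mono (f≤g ∘ suc))

  ∑-≤-* : {f : Fin k → ℕ} (c : ℕ) → (∀ i → f i ≤ c) → ∑ f ≤ k * c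
  ∑-≤-* {k = zero}  c f≤c = z≤n
  ∑-≤-* {k = suc k} c f≤c = +-mono-≤ (f≤c zero) (∑-≤-* c (f≤c ∘ suc))

  -- Pigeonhole by telescoping: `t` increments that all exceed `c` add up to at least `t * suc c`.
  smallIncrement : (f g : ℕ → ℕ) → (∀ j → g j + f j ≤ f (suc j)) → (c t : ℕ) →
    (∃ λ j → j < t × g j ≤ c) ⊎ t * suc c ≤ f t
  smallIncrement f g inc c zero = inj₂ z≤n
  smallIncrement f g inc c (suc t) with smallIncrement f g inc c t
  ... | inj₁ (j , j<t , gj≤c) = inj₁ (j , m<n⇒m<1+n j<t , gj≤c)
  ... | inj₂ le with g t ≤? c
  ...   | yes gt≤c = inj₁ (t , ≤-refl , gt≤c)
  ...   | no  gt≰c = inj₂ (≤-trans (+-mono-≤ (≰⇒> gt≰c) le) (inc t))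

  -- Paths, connected sets and components

  module _ {n : ℕ} (G : Graph n) where

    infix 4 _~_

    _~_ : Fin n → Fin n → Set
    x ~ y = adj G x y ≡ true

    ~-sym : ∀ {x y} → x ~ y → y ~ x
    ~-sym {x} {y} = trans (Defs.sym G y x)

    N[_] : Subset n → Subset n
    N[ S ] = subsetOf λ v → any? λ u → (u ∈? S) ×-dec (adj G u v ≟ᵇ true)

    ∈N⁺ : ∀ {S u v} → u ∈ S → u ~ v → v ∈ N[ S ]
    ∈N⁺ {S} u∈S u~v = ∈-subsetOf⁺ (λ v → any? λ u → (u ∈? S) ×-dec (adj G u v ≟ᵇ true)) (_ , u∈S , u~v)

    ∈N⁻ : ∀ {S v} → v ∈ N[ S ] → ∃ λ u → u ∈ S × u ~ v
    ∈N⁻ {S} = ∈-subsetOf⁻ (λ v → any? λ u → (u ∈? S) ×-dec (adj G u v ≟ᵇ true))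

    module _ {P : Fin n → Set} where

      path-head : ∀ {x y} → PathIn G P x y → P x
      path-head (here px)     = px
      path-head (step px _ _) = px

      _++ᵖ_ : ∀ {x y z} → PathIn G P x y → PathIn G P y z → PathIn G P x z
      here _         ++ᵖ q = q
      step px x~w p  ++ᵖ q = step px x~w (p ++ᵖ q)

      path-sym : ∀ {x y} → PathIn G P x y → PathIn G P y x
      path-sym (here px)        = here px
      path-sym (step px x~z p) = path-sym p ++ᵖ step (path-head p) (~-sym x~z) (here px)

    path-map : ∀ {P Q : Fin n → Set} → (∀ {x} → P x → Q x) → ∀ {x y} → PathIn G P x y → PathIn G Q x y
    path-map f (here px)       = here (f px)
    path-map f (step px x~z p) = step (f px) x~z (path-map f p)

    Path : Subset n → Fin n → Fin n → Set
    Path S = PathIn G (_∈ S)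

    Connected : Subset n → Set
    Connected S = Nonempty S × (∀ {x y} → x ∈ S → y ∈ S → Path S x y)

    connected-⁅⁆ : ∀ v → Connected ⁅ v ⁆
    connected-⁅⁆ v = (v , x∈⁅x⁆ v) , λ x∈ y∈ → path x∈ (x∈⁅y⁆⇒x≡y v x∈) (x∈⁅y⁆⇒x≡y v y∈)
      where
      path : ∀ {x y} → x ∈ ⁅ v ⁆ → x ≡ v → y ≡ v → Path ⁅ v ⁆ x y
      path x∈ refl refl = here x∈

    connected-insert : ∀ {S u v} → Connected S → u ∈ S → u ~ v → Connected (⁅ v ⁆ ∪ S)
    connected-insert {S} {u} {v} (_ , conn) u∈S u~v = (v , v∈) , λ x∈ y∈ → path-sym (fromV x∈) ++ᵖ fromV y∈
      where
      S⊆ : S ⊆ ⁅ v ⁆ ∪ S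
      S⊆ = q⊆p∪q ⁅ v ⁆ S
      v∈ : v ∈ ⁅ v ⁆ ∪ S
      v∈ = p⊆p∪q S (x∈⁅x⁆ v)
      fromV : ∀ {x} → x ∈ ⁅ v ⁆ ∪ S → Path (⁅ v ⁆ ∪ S) v x
      fromV x∈ with x∈p∪q⁻ ⁅ v ⁆ S x∈
      ... | inj₁ x∈v with refl ← x∈⁅y⁆⇒x≡y v x∈v = here v∈
      ... | inj₂ x∈S = step v∈ (~-sym u~v) (path-map S⊆ (conn u∈S x∈S))

    -- The seed `S` need not lie in `W`. This covers both uses: growing a vertex to its component,
    -- and extending a branch set into a region disjoint from it.
    record Growth (W S : Subset n) : Set where
      field
        grown   : Subset n
        extends : S ⊆ grown
        within  : ∀ {x} → x ∈ grown → x ∈ S ⊎ x ∈ W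
        closed  : ∀ {x y} → x ∈ grown → x ~ y → y ∈ W → y ∈ grown
        conn    : Connected grown

    grow : ∀ W S → Connected S → Growth W S
    grow W S = go ∣ W ─ S ∣ S ≤-refl
      where
      go : ∀ f S → ∣ W ─ S ∣ ≤ f → Connected S → Growth W S
      go f S le conn with nonempty? ((W ─ S) ∩ N[ S ])
      ... | no stuck = record
        { grown = S ; extends = id ; within = inj₁ ; conn = conn
        ; closed = λ x∈S x~y y∈W → decidable-stable (_ ∈? S) λ y∉S →
            stuck (_ , x∈p∩q⁺ (x∈p∧x∉q⇒x∈p─q y∈W y∉S , ∈N⁺ x∈S x~y)) }
      ... | yes (v , v∈) with x∈p∩q⁻ (W ─ S) N[ S ] v∈
      go zero S le conn | yes (v , _) | v∈W─S , _ =
        contradiction (≤-trans (p∩q≢∅⇒∣p─q∣<∣p∣ (W ─ S) ⁅ v ⁆ (v , x∈p∩q⁺ (v∈W─S , x∈⁅x⁆ v))) le) λ ()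
      go (suc f) S le conn | yes (v , _) | v∈W─S , v∈N with ∈N⁻ v∈N
      ... | u , u∈S , u~v = record
        { grown = R.grown ; extends = R.extends ∘ q⊆p∪q ⁅ v ⁆ S ; conn = R.conn ; closed = R.closed
        ; within = λ x∈ → [ (λ x∈vS → [ (λ x∈v → inj₂ (subst (_∈ W) (≡-sym (x∈⁅y⁆⇒x≡y v x∈v)) (p─q⊆p W S v∈W─S))) , inj₁ ]′ (x∈p∪q⁻ ⁅ v ⁆ S x∈vS)) , inj₂ ]′ (R.within x∈) }
        where
        smaller : W ─ (⁅ v ⁆ ∪ S) ⊂ W ─ S
        smaller = (λ x∈ → let (x∈W , x∉) = ∈─⁻ W _ x∈ in x∈p∧x∉q⇒x∈p─q x∈W (x∉ ∘ q⊆p∪q ⁅ v ⁆ S))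
                , v , v∈W─S , λ v∈ → x∈p─q⇒x∉q W _ v∈ (p⊆p∪q S (x∈⁅x⁆ v))
        module R = Growth (go f (⁅ v ⁆ ∪ S) (≤-pred (≤-trans (p⊂q⇒∣p∣<∣q∣ smaller) le)) (connected-insert conn u∈S u~v))

    ClosedIn : (V R C : Subset n) → Set
    ClosedIn V R C = ∀ {x y} → x ∈ C → x ~ y → y ∈ V → y ∉ R → y ∈ C

    -- A piece need not be connected; any small set that can be left within V only through R serves.
    -- This is all that the walk argument needs, and it allows an entire small remainder to be taken
    -- as one piece.
    Shattered : (V R : Subset n) → ℕ → Set
    Shattered V R K = ∀ {s} → s ∈ V → s ∉ R → ∃ λ C → s ∈ C × C ⊆ V × ∣ C ∣ ≤ K × ClosedIn V R C

    components : ∀ V N → Shattered V ⊥ N ⊎ ∃ λ D → Connected D × D ⊆ V × N < ∣ D ∣ × ClosedIn V ⊥ D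
    components V N with any? (λ s → (s ∈? V) ×-dec (N ℕ.<? ∣ Growth.grown (grow V ⁅ s ⁆ (connected-⁅⁆ s)) ∣))
    ... | yes (s , s∈V , N<) = inj₂ (grown , conn , D⊆V , N< , λ x∈ x~y y∈V _ → closed x∈ x~y y∈V)
      where
      open Growth (grow V ⁅ s ⁆ (connected-⁅⁆ s))
      D⊆V : grown ⊆ V
      D⊆V x∈ with within x∈
      ... | inj₁ x∈s with refl ← x∈⁅y⁆⇒x≡y s x∈s = s∈V
      ... | inj₂ x∈V = x∈V
    ... | no allSmall = inj₁ λ {s} s∈V _ →
      let open Growth (grow V ⁅ s ⁆ (connected-⁅⁆ s)) in
      grown , extends (x∈⁅x⁆ s)
      , (λ x∈ → [ (λ x∈s → subst (_∈ V) (≡-sym (x∈⁅y⁆⇒x≡y s x∈s)) s∈V) , id ]′ (within x∈))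
      , ≮⇒≥ (λ N< → allSmall (s , s∈V , N<))
      , (λ x∈ x~y y∈V _ → closed x∈ x~y y∈V)

    -- A small connected set meeting all given sets, or a small cut

    module TreeOrCut {k : ℕ} (C : Subset n) (A : Fin k → Subset n) where

      -- Layered search in k + 1 copies of C: v ∈ B j i when at most j vertices and jumps
      -- lead to v from anywhere in C while visiting A 0, …, A (i - 1) in this order.
      B : ℕ → Fin (suc k) → Subset n
      jump : ℕ → Fin (suc k) → Subset n

      B zero    i = ⊥
      B (suc j) i = C ∩ (B j i ∪ N[ B j i ] ∪ jump j i)

      jump j zero    = ⊤
      jump j (suc i) = A i ∩ B j (inject₁ i)

      B⊆C : ∀ j {i} → B j i ⊆ C
      B⊆C zero    v∈ = contradiction v∈ ∉⊥
      B⊆C (suc j) v∈ = proj₁ (x∈p∩q⁻ C _ v∈)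

      B-suc : ∀ j {i} → B j i ⊆ B (suc j) i
      B-suc j v∈ = x∈p∩q⁺ (B⊆C j v∈ , x∈p∪q⁺ (inj₁ v∈))

      B-mono : ∀ {j j′ i} → j ℕ.≤′ j′ → B j i ⊆ B j′ i
      B-mono (ℕ.≤′-reflexive refl) = id
      B-mono (ℕ.≤′-step {j′} j≤j′) = B-suc j′ ∘ B-mono j≤j′

      B-neighbour : ∀ j {i u v} → u ∈ B j i → u ~ v → v ∈ C → v ∈ B (suc j) i
      B-neighbour j u∈ u~v v∈C = x∈p∩q⁺ (v∈C , x∈p∪q⁺ (inj₂ (x∈p∪q⁺ (inj₁ (∈N⁺ u∈ u~v)))))

      B-jump : ∀ j {i v} → v ∈ jump j i → v ∈ C → v ∈ B (suc j) i
      B-jump j v∈ v∈C = x∈p∩q⁺ (v∈C , x∈p∪q⁺ (inj₂ (x∈p∪q⁺ (inj₂ v∈))))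

      -- Only the vertex set of the walk found by the search is kept. The walk may repeat vertices,
      -- but this set is connected and gains at most one vertex per round; a jump to the next level
      -- costs a round and adds none.
      record Visit (v : Fin n) (j : ℕ) (i : Fin (suc k)) : Set where
        field
          tree   : Subset n
          root   : v ∈ tree
          tree⊆C : tree ⊆ C
          conn   : Connected tree
          size   : ∣ tree ∣ ≤ j
          visits : ∀ m → toℕ m < toℕ i → Nonempty (tree ∩ A m)

      visit : ∀ j i {v} → v ∈ B j i → Visit v j i
      visit zero    i v∈ = contradiction v∈ ∉⊥
      visit (suc j) i {v} v∈ with x∈p∩q⁻ C _ v∈
      ... | v∈C , v∈′ with x∈p∪q⁻ (B j i) _ v∈′
      ... | inj₁ old = record { Visit (visit j i old) ; size = m≤n⇒m≤1+n (Visit.size (visit j i old)) }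
      ... | inj₂ v∈″ with x∈p∪q⁻ N[ B j i ] _ v∈″
      ... | inj₁ v∈N with ∈N⁻ v∈N
      ... | u , u∈ , u~v = record
        { tree = ⁅ v ⁆ ∪ tree
        ; root = p⊆p∪q tree (x∈⁅x⁆ v)
        ; tree⊆C = λ x∈ → [ (λ x∈v → subst (_∈ C) (≡-sym (x∈⁅y⁆⇒x≡y v x∈v)) v∈C) , tree⊆C ]′ (x∈p∪q⁻ ⁅ v ⁆ tree x∈)
        ; conn = connected-insert conn root u~v
        ; size = ≤-trans (∣p∪q∣≤∣p∣+∣q∣ ⁅ v ⁆ tree) (+-mono-≤ (≤-reflexive (∣⁅x⁆∣≡1 v)) size)
        ; visits = λ m m<i → let (x , x∈) = visits m m<i ; (x∈t , x∈A) = x∈p∩q⁻ tree (A m) x∈ in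
                             x , x∈p∩q⁺ (q⊆p∪q ⁅ v ⁆ tree x∈t , x∈A)
        }
        where open Visit (visit j i u∈)
      visit (suc j) zero {v} v∈ | v∈C , _ | inj₂ _ | inj₂ _ = record
        { tree = ⁅ v ⁆
        ; root = x∈⁅x⁆ v
        ; tree⊆C = λ x∈v → subst (_∈ C) (≡-sym (x∈⁅y⁆⇒x≡y v x∈v)) v∈C
        ; conn = connected-⁅⁆ v
        ; size = ≤-trans (≤-reflexive (∣⁅x⁆∣≡1 v)) (s≤s z≤n)
        ; visits = λ _ () }
      visit (suc j) (suc i) {v} v∈ | v∈C , _ | inj₂ _ | inj₂ v∈J with x∈p∩q⁻ (A i) _ v∈J
      ... | v∈A , v∈B = record
        { Visit (visit j (inject₁ i) v∈B)
        ; size = m≤n⇒m≤1+n size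
        ; visits = λ m m<i → case m (m≤n⇒m<n∨m≡n (≤-pred m<i)) }
        where
        open Visit (visit j (inject₁ i) v∈B)
        case : ∀ m → toℕ m < toℕ i ⊎ toℕ m ≡ toℕ i → Nonempty (tree ∩ A m)
        case m (inj₁ m<i) = visits m (subst (toℕ m <_) (≡-sym (toℕ-inject₁ i)) m<i)
        case m (inj₂ m≡i) with refl ← toℕ-injective m≡i = v , x∈p∩q⁺ (root , v∈A)

      Δ : ℕ → Fin (suc k) → Subset n
      Δ j i = B (suc j) i ─ B j i

      layer : ℕ → Subset n
      layer j = ⋃ᶠ (Δ j)

      -- The sets `Δ j i` count the new vertices in all k + 1 copies; projecting their union to `C`
      -- can only make it smaller.
      layer-increment : ∀ j → ∣ layer j ∣ + ∑ (λ i → ∣ B j i ∣) ≤ ∑ (λ i → ∣ B (suc j) i ∣)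
      layer-increment j = begin
        ∣ layer j ∣ + ∑ (λ i → ∣ B j i ∣)                    ≤⟨ +-monoˡ-≤ _ (∣⋃ᶠ∣≤∑ (Δ j)) ⟩
        ∑ (λ i → ∣ Δ j i ∣) + ∑ (λ i → ∣ B j i ∣)  ≡⟨ ≡-sym (∑-distrib-+ (λ i → ∣ Δ j i ∣) (λ i → ∣ B j i ∣)) ⟩
        ∑ (λ i → ∣ Δ j i ∣ + ∣ B j i ∣)               ≤⟨ ∑-mono (λ i → ≤-trans (≤-reflexive (+-comm ∣ Δ j i ∣ ∣ B j i ∣)) (∣q∣+∣p─q∣≤∣p∣ {p = B (suc j) i} (B-suc j))) ⟩
        ∑ (λ i → ∣ B (suc j) i ∣)                            ∎
        where open ≤-Reasoning

      Cuts : Subset n → Set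
      Cuts Z = ∀ D → Connected D → D ⊆ C → Empty (D ∩ Z) → ∃ λ i → Empty (D ∩ A i)

      -- A set `D` that avoids the layer discovers nothing new in round j + 1. So if `D` meets every
      -- `A i`, induction over the levels puts all of `D` into `B j i`: a vertex of `D` in `A i`
      -- would be jumped to in that round, hence was there before, and the same argument carries
      -- membership along paths in `D`. Then `D` occupies the last level, which is still empty after
      -- τ rounds.
      layer-cuts : ∀ {j τ} → j < τ → Empty (B τ (fromℕ k)) → Cuts (layer j)
      layer-cuts {j} {τ} j<τ unreached D ((x₀ , x₀∈D) , conn) D⊆C D∩Z=∅
        with all? (λ i → nonempty? (D ∩ A i))
      ... | no missed = ¬∀⟶∃¬ _ (λ i → Nonempty (D ∩ A i)) (λ i → nonempty? (D ∩ A i)) missed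
      ... | yes meets = contradiction (x₀ , B-mono (≤⇒≤′ (<⇒≤ j<τ)) (D⊆B (fromℕ k) x₀∈D)) unreached
        where
        settle : ∀ {i x} → x ∈ D → x ∈ B (suc j) i → x ∈ B j i
        settle {i} {x} x∈D x∈B = decidable-stable (x ∈? B j i) λ x∉B →
          D∩Z=∅ (x , x∈p∩q⁺ (x∈D , ∈⋃ᶠ (Δ j) i (x∈p∧x∉q⇒x∈p─q x∈B x∉B)))

        spread : ∀ {i x y} → x ∈ B j i → Path D x y → y ∈ B j i
        spread x∈B (here _)       = x∈B
        spread x∈B (step _ x~z p) = spread (settle (path-head p) (B-neighbour j x∈B x~z (D⊆C (path-head p)))) p

        D⊆B : ∀ i → D ⊆ B j i
        D⊆B = <-weakInduction (λ i → D ⊆ B j i)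
          (λ x∈D → settle x∈D (B-jump j ∈⊤ (D⊆C x∈D)))
          (λ i D⊆Bi x∈D →
            let (a , a∈) = meets i ; (a∈D , a∈A) = x∈p∩q⁻ D (A i) a∈ in
            spread (settle a∈D (B-jump j (x∈p∩q⁺ (a∈A , D⊆Bi a∈D)) (D⊆C a∈D))) (conn a∈D x∈D))

      -- The k + 1 copies of `C` have at most τ² < τ(τ + 1) vertices together, so one of the first τ
      -- rounds adds at most τ of them. If the last level stays empty, that round is the cut.
      treeOrCut : ∀ τ → suc k * ∣ C ∣ ≤ τ * τ → 0 < τ →
        (∃ λ S → Connected S × S ⊆ C × ∣ S ∣ ≤ τ × (∀ i → Nonempty (S ∩ A i)))
        ⊎ (∃ λ Z → ∣ Z ∣ ≤ τ × Cuts Z)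
      treeOrCut τ bound τ>0 with nonempty? (B τ (fromℕ k))
      ... | yes (v , v∈) = inj₁ (tree , conn , tree⊆C , size , λ m → visits m (subst (toℕ m <_) (≡-sym (toℕ-fromℕ k)) (toℕ<n m)))
        where open Visit (visit τ (fromℕ k) v∈)
      ... | no unreached with smallIncrement (λ j → ∑ (λ i → ∣ B j i ∣)) (∣_∣ ∘ layer) layer-increment τ τ
      ...   | inj₁ (j , j<τ , small) = inj₂ (layer j , small , layer-cuts j<τ unreached)
      ...   | inj₂ large = contradiction (begin-strict
                τ * τ                  <⟨ *-monoʳ-< τ {{ℕ.>-nonZero τ>0}} ≤-refl ⟩
                τ * suc τ              ≤⟨ large ⟩
                ∑ (λ i → ∣ B τ i ∣)    ≤⟨ ∑-≤-* ∣ C ∣ (λ i → p⊆q⇒∣p∣≤∣q∣ (B⊆C τ {i})) ⟩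
                suc k * ∣ C ∣          ≤⟨ bound ⟩
                τ * τ                  ∎) (<-irrefl refl)
        where open ≤-Reasoning

    -- Models of complete graphs

    Linked : Subset n → Subset n → Set
    Linked P Q = Empty (P ∩ Q) × ∃ λ x → ∃ λ y → x ∈ P × y ∈ Q × x ~ y

    linked-sym : ∀ {P Q} → Linked P Q → Linked Q P
    linked-sym {P} {Q} (disj , x , y , x∈P , y∈Q , x~y) =
      (λ (v , v∈) → let (v∈Q , v∈P) = x∈p∩q⁻ Q P v∈ in disj (v , x∈p∩q⁺ (v∈P , v∈Q))) ,
      y , x , y∈Q , x∈P , ~-sym x~y

    record Clique {k} (T : Fin k → Subset n) : Set where
      field
        conn   : ∀ i → Connected (T i)
        linked : ∀ {i j} → i ≢ j → Linked (T i) (T j)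

    clique-remove : ∀ {k} {T : Fin (suc k) → Subset n} i → Clique T → Clique (T ∘ punchIn i)
    clique-remove i c = record
      { conn = conn ∘ punchIn i ; linked = λ j≢l → linked (j≢l ∘ punchIn-injective i _ _) }
      where open Clique c

    clique-insert : ∀ {k} {T : Fin k → Subset n} {S} →
      Connected S → (∀ i → Linked S (T i)) → Clique T → Clique (S ∷ᵛ T)
    clique-insert {k} {T} {S} connS linkedS c = record { conn = conn′ ; linked = linked′ }
      where
      open Clique c
      conn′ : ∀ i → Connected ((S ∷ᵛ T) i)
      conn′ zero    = connS
      conn′ (suc i) = conn i
      linked′ : ∀ {i j} → i ≢ j → Linked ((S ∷ᵛ T) i) ((S ∷ᵛ T) j)
      linked′ {zero}  {zero}  i≢j = contradiction refl i≢j
      linked′ {zero}  {suc j} i≢j = linkedS j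
      linked′ {suc i} {zero}  i≢j = linked-sym (linkedS i)
      linked′ {suc i} {suc j} i≢j = linked (i≢j ∘ cong suc)

    clique-minor : ∀ {r} {T : Fin r → Subset n} → Clique T → (H : Graph r) → HasMinor G H
    clique-minor {T = T} c H =
      (λ u v → v ∈ T u) , (λ _ _ _ → tt) , (λ u → proj₁ (conn u)) , (λ u x y → proj₂ (conn u)) , disjoint , edge
      where
      open Clique c
      disjoint : ∀ u u′ v → v ∈ T u → v ∈ T u′ → u ≡ u′
      disjoint u u′ v v∈ v∈′ = decidable-stable (u ≟ u′) λ u≢u′ →
        proj₁ (linked u≢u′) (v , x∈p∩q⁺ (v∈ , v∈′))
      irreflexive : ∀ {u u′} → adj H u u′ ≡ true → u ≢ u′
      irreflexive {u} u~u refl with trans (≡-sym u~u) (irrefl H u)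
      ... | ()
      edge : ∀ u u′ → adj H u u′ ≡ true → ∃ λ x → ∃ λ y → x ∈ T u × y ∈ T u′ × adj G x y ≡ true
      edge u u′ u~u′ = proj₂ (linked (irreflexive u~u′))

    -- Separators in graphs without a clique minor

    module Separator (N τ : ℕ) (U : Subset n) where

      -- A branch set `T i` has to stay connected and may become large, whereas the separator must
      -- be small. So each branch set carries a part `X i` of at most τ vertices, and `boundary`
      -- says that within `U` the large set `C` touches the outside only in these parts. Their union
      -- therefore separates `C` from the rest of `U`.
      record State (k : ℕ) : Set where
        field
          T X      : Fin k → Subset n
          C        : Subset n
          clique   : Clique T
          X⊆T      : ∀ i → X i ⊆ T i
          ∣X∣≤τ    : ∀ i → ∣ X i ∣ ≤ τ
          C∩T      : ∀ i {x} → x ∈ C → x ∉ T i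
          C⊆U      : C ⊆ U
          large    : N < ∣ C ∣
          boundary : ∀ {x y} → x ∈ C → x ~ y → y ∈ U → y ∉ C → ∃ λ i → y ∈ X i

        attachment : Fin k → Subset n
        attachment i = C ∩ N[ T i ]

        -- A new branch set costs 1 but removes a vertex from C, which gains 2.
        measure : ℕ
        measure = 2 * ∣ C ∣ + k

      open State

      -- Since `X i` lies in `T i`, which has no neighbour in `C`, it contains no boundary vertex of
      -- `C`, and `boundary` survives its removal.
      drop : ∀ {k} (S : State (suc k)) i → Empty (attachment S i) → State k
      drop S i unattached = record
        { T = T S ∘ punchIn i ; X = X S ∘ punchIn i ; C = C S
        ; clique = clique-remove i (clique S)
        ; X⊆T = X⊆T S ∘ punchIn i ; ∣X∣≤τ = ∣X∣≤τ S ∘ punchIn i ; C∩T = C∩T S ∘ punchIn i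
        ; C⊆U = C⊆U S ; large = large S ; boundary = boundary′ }
        where
        boundary′ : ∀ {x y} → x ∈ C S → x ~ y → y ∈ U → y ∉ C S → ∃ λ j → y ∈ X S (punchIn i j)
        boundary′ {x} {y} x∈ x~y y∈U y∉C with boundary S x∈ x~y y∈U y∉C
        ... | j , y∈X with i ≟ j
        ... | yes refl = contradiction (x , x∈p∩q⁺ (x∈ , ∈N⁺ (X⊆T S i y∈X) (~-sym x~y))) unattached
        ... | no i≢j = punchOut i≢j , subst (λ j → y ∈ X S j) (≡-sym (punchIn-punchOut i≢j)) y∈X

      add : ∀ {k} (S : State k) (S′ : Subset n) → Connected S′ → S′ ⊆ C S → ∣ S′ ∣ ≤ τ →
        (∀ i → Nonempty (S′ ∩ attachment S i)) → N < ∣ C S ─ S′ ∣ → State (suc k)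
      add {k} S S′ conn S′⊆C S′≤τ meets large′ = record
        { T = S′ ∷ᵛ T S ; X = S′ ∷ᵛ X S ; C = C S ─ S′
        ; clique = clique-insert conn linked (clique S)
        ; X⊆T = X⊆T′ ; ∣X∣≤τ = ∣X∣≤τ′ ; C∩T = C∩T′
        ; C⊆U = C⊆U S ∘ p─q⊆p (C S) S′ ; large = large′ ; boundary = boundary′ }
        where
        linked : ∀ i → Linked S′ (T S i)
        linked i =
          let (x , x∈) = meets i
              (x∈S′ , x∈A) = x∈p∩q⁻ S′ (attachment S i) x∈
              (t , t∈T , t~x) = ∈N⁻ (proj₂ (x∈p∩q⁻ (C S) _ x∈A))
          in (λ (v , v∈) → let (v∈S′ , v∈T) = x∈p∩q⁻ S′ (T S i) v∈ in C∩T S i (S′⊆C v∈S′) v∈T)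
           , x , t , x∈S′ , t∈T , ~-sym t~x
        X⊆T′ : ∀ i → (S′ ∷ᵛ X S) i ⊆ (S′ ∷ᵛ T S) i
        X⊆T′ zero    = id
        X⊆T′ (suc i) = X⊆T S i
        ∣X∣≤τ′ : ∀ i → ∣ (S′ ∷ᵛ X S) i ∣ ≤ τ
        ∣X∣≤τ′ zero    = S′≤τ
        ∣X∣≤τ′ (suc i) = ∣X∣≤τ S i
        C∩T′ : ∀ i {x} → x ∈ C S ─ S′ → x ∉ (S′ ∷ᵛ T S) i
        C∩T′ zero    x∈ = x∈p─q⇒x∉q (C S) S′ x∈
        C∩T′ (suc i) x∈ = C∩T S i (p─q⊆p (C S) S′ x∈)
        boundary′ : ∀ {x y} → x ∈ C S ─ S′ → x ~ y → y ∈ U → y ∉ C S ─ S′ → ∃ λ i → y ∈ (S′ ∷ᵛ X S) i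
        boundary′ {x} {y} x∈ x~y y∈U y∉ with y ∈? S′ | y ∈? C S
        ... | yes y∈S′ | _ = zero , y∈S′
        ... | no y∉S′ | yes y∈C = contradiction (x∈p∧x∉q⇒x∈p─q y∈C y∉S′) y∉
        ... | no y∉S′ | no y∉C = let (i , y∈X) = boundary S (p─q⊆p (C S) S′ x∈) x~y y∈U y∉C in suc i , y∈X

      -- The large component D left by the cut Z has no neighbour in T i, so T i can absorb the rest of
      -- C on its side, and Z takes over the role of X i.
      module Advance {k} (S : State (suc k)) (i : Fin (suc k)) (Z D : Subset n) (Z≤τ : ∣ Z ∣ ≤ τ)
        (attached : Nonempty (attachment S i)) (D⊆C─Z : D ⊆ C S ─ Z) (D-large : N < ∣ D ∣)
        (D-closed : ClosedIn (C S ─ Z) ⊥ D) (D-misses : Empty (D ∩ attachment S i)) where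

        D⊆C : D ⊆ C S
        D⊆C = p─q⊆p (C S) Z ∘ D⊆C─Z

        open Growth (grow (C S ─ D) (T S i) (Clique.conn (clique S) i)) renaming (grown to T′)

        D∩T′ : ∀ {x} → x ∈ D → x ∉ T′
        D∩T′ x∈D x∈T′ with within x∈T′
        ... | inj₁ x∈T = C∩T S i (D⊆C x∈D) x∈T
        ... | inj₂ x∈C─D = x∈p─q⇒x∉q (C S) D x∈C─D x∈D

        absorbed : attachment S i ⊆ C S ∩ T′
        absorbed x∈A =
          let (x∈C , x∈N) = x∈p∩q⁻ (C S) _ x∈A
              (t , t∈T , t~x) = ∈N⁻ x∈N
          in x∈p∩q⁺ (x∈C , closed (extends t∈T) t~x
               (x∈p∧x∉q⇒x∈p─q x∈C λ x∈D → D-misses (_ , x∈p∩q⁺ (x∈D , x∈A))))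

        shrinks : ∣ C S ─ T′ ∣ < ∣ C S ∣
        shrinks = p∩q≢∅⇒∣p─q∣<∣p∣ (C S) T′ (proj₁ attached , absorbed (proj₂ attached))

        next : State (suc k)
        next = record
          { T = T′ ∷ᵛ (T S ∘ punchIn i) ; X = (Z ∩ T′) ∷ᵛ (X S ∘ punchIn i) ; C = C S ─ T′
          ; clique = clique-insert conn linked (clique-remove i (clique S))
          ; X⊆T = X⊆T′ ; ∣X∣≤τ = ∣X∣≤τ′ ; C∩T = C∩T′
          ; C⊆U = C⊆U S ∘ p─q⊆p (C S) T′
          ; large = <-≤-trans D-large (p⊆q⇒∣p∣≤∣q∣ λ x∈D → x∈p∧x∉q⇒x∈p─q (D⊆C x∈D) (D∩T′ x∈D))
          ; boundary = boundary′ }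
          where
          linked : ∀ j → Linked T′ (T S (punchIn i j))
          linked j with Clique.linked (clique S) (punchInᵢ≢i i j ∘ ≡-sym)
          ... | disj , x , y , x∈T , y∈T , x~y =
            (λ (v , v∈) → let (v∈T′ , v∈Tj) = x∈p∩q⁻ T′ _ v∈ in
              [ (λ v∈T → disj (v , x∈p∩q⁺ (v∈T , v∈Tj))) , (λ v∈C─D → C∩T S (punchIn i j) (p─q⊆p (C S) D v∈C─D) v∈Tj) ]′ (within v∈T′))
            , x , y , extends x∈T , y∈T , x~y
          X⊆T′ : ∀ j → ((Z ∩ T′) ∷ᵛ (X S ∘ punchIn i)) j ⊆ (T′ ∷ᵛ (T S ∘ punchIn i)) j
          X⊆T′ zero    = p∩q⊆q Z T′
          X⊆T′ (suc j) = X⊆T S (punchIn i j)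
          ∣X∣≤τ′ : ∀ j → ∣ ((Z ∩ T′) ∷ᵛ (X S ∘ punchIn i)) j ∣ ≤ τ
          ∣X∣≤τ′ zero    = ≤-trans (∣p∩q∣≤∣p∣ Z T′) Z≤τ
          ∣X∣≤τ′ (suc j) = ∣X∣≤τ S (punchIn i j)
          C∩T′ : ∀ j {x} → x ∈ C S ─ T′ → x ∉ (T′ ∷ᵛ (T S ∘ punchIn i)) j
          C∩T′ zero    x∈ = x∈p─q⇒x∉q (C S) T′ x∈
          C∩T′ (suc j) x∈ = C∩T S (punchIn i j) (p─q⊆p (C S) T′ x∈)
          boundary′ : ∀ {x y} → x ∈ C S ─ T′ → x ~ y → y ∈ U → y ∉ C S ─ T′ →
            ∃ λ j → y ∈ ((Z ∩ T′) ∷ᵛ (X S ∘ punchIn i)) j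
          boundary′ {x} {y} x∈ x~y y∈U y∉ with ∈─⁻ (C S) T′ x∈ | y ∈? C S
          ... | x∈C , x∉T′ | no y∉C with boundary S x∈C x~y y∈U y∉C
          ...   | j , y∈X with i ≟ j
          -- The old `X i` can be given up: a neighbour of it in `C` belongs to the attachment and
          -- has been absorbed into `T′`.
          ...     | yes refl = contradiction (proj₂ (x∈p∩q⁻ (C S) T′ (absorbed (x∈p∩q⁺ (x∈C , ∈N⁺ (X⊆T S i y∈X) (~-sym x~y)))))) x∉T′
          ...     | no i≢j = suc (punchOut i≢j) , subst (λ j → y ∈ X S j) (≡-sym (punchIn-punchOut i≢j)) y∈X
          -- For a new boundary edge from `x` to `y` in `T′`, the vertex `x` lies in `D`, as the
          -- growth would otherwise have taken it. Then `y` lies in `Z`, as the closure of `D` in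
          -- `C ─ Z` would otherwise put `y` into `D`, which is disjoint from `T′`.
          boundary′ {x} {y} x∈ x~y y∈U y∉ | x∈C , x∉T′ | yes y∈C = zero , x∈p∩q⁺ (y∈Z , y∈T′)
            where
            y∈T′ : y ∈ T′
            y∈T′ = decidable-stable (y ∈? T′) λ y∉T′ → y∉ (x∈p∧x∉q⇒x∈p─q y∈C y∉T′)
            x∈D : x ∈ D
            x∈D = decidable-stable (x ∈? D) λ x∉D → x∉T′ (closed y∈T′ (~-sym x~y) (x∈p∧x∉q⇒x∈p─q x∈C x∉D))
            y∈Z : y ∈ Z
            y∈Z = decidable-stable (y ∈? Z) λ y∉Z →
              D∩T′ (D-closed x∈D x~y (x∈p∧x∉q⇒x∈p─q y∈C y∉Z) ∉⊥) y∈T′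

      module _ (r : ℕ) (U≤2N : ∣ U ∣ ≤ 2 * N) (rU≤τ² : r * ∣ U ∣ ≤ τ * τ) (noClique : ∀ {T : Fin r → Subset n} → ¬ Clique T) (τ>0 : 0 < τ) where

        Separated : Set
        Separated = ∃ λ Y → ∣ Y ∣ ≤ r * τ × Shattered U Y N

        -- The separator consists of `W` and at most r - 1 parts `X i`, all of size at most τ. As
        -- `C` has more than N of the at most 2N vertices, what lies outside `C` has fewer than N
        -- and is a single piece; edges between it and `C` end in some `X i`.
        finish : ∀ {k} (S : State k) → k < r → (W : Subset n) → ∣ W ∣ ≤ τ → Shattered (C S ─ W) ⊥ N → Separated
        finish {k} S k<r W W≤τ shattered = Y , ∣Y∣≤ , pieces
          where
          open ≤-Reasoning
          Y = W ∪ ⋃ᶠ (X S)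
          ∣Y∣≤ : ∣ Y ∣ ≤ r * τ
          ∣Y∣≤ = begin
            ∣ W ∪ ⋃ᶠ (X S) ∣                  ≤⟨ ∣p∪q∣≤∣p∣+∣q∣ W _ ⟩
            ∣ W ∣ + ∣ ⋃ᶠ (X S) ∣              ≤⟨ +-mono-≤ W≤τ (≤-trans (∣⋃ᶠ∣≤∑ (X S)) (∑-≤-* τ (∣X∣≤τ S))) ⟩
            suc k * τ                         ≤⟨ *-monoˡ-≤ τ k<r ⟩
            r * τ                             ∎
          leaving : ∀ {x y} → x ∈ C S → x ~ y → y ∈ U → y ∉ C S → y ∈ Y
          leaving x∈ x~y y∈U y∉C = let (i , y∈X) = boundary S x∈ x~y y∈U y∉C in q⊆p∪q W _ (∈⋃ᶠ (X S) i y∈X)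
          rest≤N : ∣ U ─ C S ∣ ≤ N
          rest≤N = +-cancelˡ-≤ ∣ C S ∣ _ _ (begin
            ∣ C S ∣ + ∣ U ─ C S ∣   ≤⟨ ∣q∣+∣p─q∣≤∣p∣ (C⊆U S) ⟩
            ∣ U ∣                   ≤⟨ U≤2N ⟩
            N + (N + 0)             ≡⟨ cong (N +_) (+-identityʳ N) ⟩
            N + N                   ≤⟨ +-monoˡ-≤ N (<⇒≤ (large S)) ⟩
            ∣ C S ∣ + N             ∎)
          pieces : Shattered U Y N
          pieces {s} s∈U s∉Y with s ∈? C S
          ... | yes s∈C =
            let (P , s∈P , P⊆ , P≤N , P-closed) = shattered (x∈p∧x∉q⇒x∈p─q s∈C (s∉Y ∘ p⊆p∪q _)) ∉⊥ in
            P , s∈P , C⊆U S ∘ p─q⊆p (C S) W ∘ P⊆ , P≤N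
            , λ {x} {y} x∈P x~y y∈U y∉Y → P-closed x∈P x~y
                (x∈p∧x∉q⇒x∈p─q
                  (decidable-stable (y ∈? C S) λ y∉C → y∉Y (leaving (p─q⊆p (C S) W (P⊆ x∈P)) x~y y∈U y∉C))
                  (y∉Y ∘ p⊆p∪q _))
                ∉⊥
          ... | no s∉C =
            (U ─ C S) ─ Y , x∈p∧x∉q⇒x∈p─q (x∈p∧x∉q⇒x∈p─q s∈U s∉C) s∉Y , p─q⊆p U (C S) ∘ p─q⊆p (U ─ C S) Y
            , ≤-trans (∣p─q∣≤∣p∣ (U ─ C S) Y) rest≤N
            , λ x∈ x~y y∈U y∉Y →
                let (x∈U─C , x∉Y) = ∈─⁻ (U ─ C S) Y x∈ ; (x∈U , x∉C) = ∈─⁻ U (C S) x∈U─C in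
                x∈p∧x∉q⇒x∈p─q (x∈p∧x∉q⇒x∈p─q y∈U λ y∈C → x∉Y (leaving y∈C (~-sym x~y) x∈U x∉C)) y∉Y

        Progress : ∀ {k} → State k → Set
        Progress S = Separated ⊎ ∃ λ k → k ≤ r × ∃ λ (S′ : State k) → measure S′ < measure S

        dropStep : ∀ {k} → k ≤ r → (S : State k) (i : Fin k) → Empty (attachment S i) → Progress S
        dropStep {suc k} k<r S i unattached =
          inj₂ (k , <⇒≤ k<r , drop S i unattached , +-monoʳ-< (2 * ∣ C S ∣) ≤-refl)

        addStep : ∀ {k} → k < r → (S : State k) (S′ : Subset n) → Connected S′ → S′ ⊆ C S → ∣ S′ ∣ ≤ τ →
          (∀ i → Nonempty (S′ ∩ attachment S i)) → Progress S
        addStep {k} k<r S S′ conn S′⊆C S′≤τ meets with N ℕ.<? ∣ C S ─ S′ ∣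
        ... | yes large′ = inj₂ (suc k , k<r , add S S′ conn S′⊆C S′≤τ meets large′ , (begin-strict
            2 * ∣ C S ─ S′ ∣ + suc k     <⟨ n<1+n _ ⟩
            suc (2 * ∣ C S ─ S′ ∣ + suc k)  ≡⟨ lem ∣ C S ─ S′ ∣ k ⟩
            2 * suc ∣ C S ─ S′ ∣ + k     ≤⟨ +-monoˡ-≤ k (*-monoʳ-≤ 2 shrinks) ⟩
            2 * ∣ C S ∣ + k              ∎))
          where
          open ≤-Reasoning
          lem : ∀ c k → suc (2 * c + suc k) ≡ 2 * suc c + k
          lem = solve-∀
          shrinks : ∣ C S ─ S′ ∣ < ∣ C S ∣
          shrinks = let (v , v∈) = proj₁ conn in p∩q≢∅⇒∣p─q∣<∣p∣ (C S) S′ (v , x∈p∩q⁺ (S′⊆C v∈ , v∈))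
        -- At most N vertices of `C` remain, so they form one piece, and `S′` goes into the
        -- separator instead of the clique.
        ... | no small = inj₁ (finish S k<r S′ S′≤τ λ s∈ _ →
            C S ─ S′ , s∈ , id , ≮⇒≥ small , λ _ _ y∈ _ → y∈)

        cutStep : ∀ {k} → k < r → (S : State k) (Z : Subset n) → ∣ Z ∣ ≤ τ →
          TreeOrCut.Cuts (C S) (attachment S) Z → (∀ i → Nonempty (attachment S i)) → Progress S
        cutStep {k} k<r S Z Z≤τ cuts attached with components (C S ─ Z) N
        ... | inj₁ shattered = inj₁ (finish S k<r Z Z≤τ shattered)
        ... | inj₂ (D , connD , D⊆ , D-large , D-closed)
          with cuts D connD (p─q⊆p (C S) Z ∘ D⊆) (λ (v , v∈) → let (v∈D , v∈Z) = x∈p∩q⁻ D Z v∈ in x∈p─q⇒x∉q (C S) Z (D⊆ v∈D) v∈Z)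
        -- Without branch sets the index of a missed attachment would be an element of `Fin 0`, so
        -- the number of branch sets is a successor here.
        cutStep {suc k} k<r S Z Z≤τ cuts attached | inj₂ (D , connD , D⊆ , D-large , D-closed) | i , misses =
          inj₂ (suc k , <⇒≤ k<r , A.next , +-monoˡ-< (suc k) (*-monoʳ-< 2 A.shrinks))
          where module A = Advance S i Z D Z≤τ (attached i) D⊆ D-large D-closed misses

        progress : ∀ {k} → k ≤ r → (S : State k) → Progress S
        progress {k} k≤r S with m≤n⇒m<n∨m≡n k≤r
        ... | inj₂ refl = contradiction (clique S) noClique
        ... | inj₁ k<r with all? (λ i → nonempty? (attachment S i))
        ... | no unattached =
          let (i , empty) = ¬∀⟶∃¬ k (λ i → Nonempty (attachment S i)) (λ i → nonempty? (attachment S i)) unattached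
          in dropStep k≤r S i empty
        ... | yes attached with TreeOrCut.treeOrCut (C S) (attachment S) τ
                                 (≤-trans (*-mono-≤ k<r (p⊆q⇒∣p∣≤∣q∣ (C⊆U S))) rU≤τ²) τ>0
        ... | inj₁ (S′ , conn , S′⊆C , S′≤τ , meets) = addStep k<r S S′ conn S′⊆C S′≤τ meets
        ... | inj₂ (Z , Z≤τ , cuts) = cutStep k<r S Z Z≤τ cuts attached

        run : ∀ f {k} → k ≤ r → (S : State k) → measure S ≤ f → Separated
        run f k≤r S le with progress k≤r S
        run f       k≤r S le | inj₁ done = done
        run (suc f) k≤r S le | inj₂ (_ , k′≤r , S′ , lt) = run f k′≤r S′ (≤-pred (≤-trans lt le))
        run zero    k≤r S le | inj₂ (_ , k′≤r , S′ , lt) = contradiction (≤-trans lt le) λ ()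

        separate : Separated
        separate with N ℕ.<? ∣ U ∣
        ... | yes N<U = run _ z≤n initial ≤-refl
          where
          initial : State 0
          initial = record
            { T = λ () ; X = λ () ; C = U ; clique = record { conn = λ () ; linked = λ { {()} } }
            ; X⊆T = λ () ; ∣X∣≤τ = λ () ; C∩T = λ () ; C⊆U = id ; large = N<U
            ; boundary = λ _ _ y∈U y∉U → contradiction y∈U y∉U }
        ... | no N≮U = ⊥ , ≤-trans (≤-reflexive (∣⊥∣≡0 n)) z≤n , λ s∈U _ → U , s∈U , id , ≮⇒≥ N≮U , λ _ _ y∈U _ → y∈U

    -- Iterated separation down to pieces of bounded size

    module _ (K : ℕ) where

      -- The deleted fraction is at most a/b, cross-multiplied to remain in the natural numbers.
      Decomposable : (N a b : ℕ) → Set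
      Decomposable N a b = ∀ U → ∣ U ∣ ≤ N → ∃ λ R → ∣ R ∣ * b ≤ a * ∣ U ∣ × Shattered U R K

      -- Pieces may overlap, so they are split off one at a time and the others restricted to what
      -- is left. The costs then add up over disjoint sets.
      decompose-pieces : ∀ {N a b} → Decomposable N a b → ∀ V → Shattered V ⊥ N →
        ∃ λ R → ∣ R ∣ * b ≤ a * ∣ V ∣ × Shattered V R K
      decompose-pieces {N} {a} {b} dec V = go ∣ V ∣ V ≤-refl
        where
        go : ∀ f V → ∣ V ∣ ≤ f → Shattered V ⊥ N → ∃ λ R → ∣ R ∣ * b ≤ a * ∣ V ∣ × Shattered V R K
        go f V V≤f shattered with nonempty? V
        ... | no empty = ⊥ , ≤-trans (≤-reflexive (cong (_* b) (∣⊥∣≡0 n))) z≤n , λ s∈V → contradiction (_ , s∈V) empty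
        ... | yes (s , s∈V) with shattered s∈V ∉⊥
        go zero V V≤f shattered | yes (s , s∈V) | _ =
          contradiction (≤-trans (p∩q≢∅⇒∣p─q∣<∣p∣ V ⁅ s ⁆ (s , x∈p∩q⁺ (s∈V , x∈⁅x⁆ s))) V≤f) λ ()
        go (suc f) V V≤f shattered | yes (s , s∈V) | C , s∈C , C⊆V , C≤N , C-closed
          with dec C C≤N | go f (V ─ C) (≤-pred (≤-trans (p∩q≢∅⇒∣p─q∣<∣p∣ V C (s , x∈p∩q⁺ (s∈V , s∈C))) V≤f)) rest
          where
          rest : Shattered (V ─ C) ⊥ N
          rest {v} v∈ _ =
            let (v∈V , v∉C) = ∈─⁻ V C v∈ ; (P , v∈P , P⊆V , P≤N , P-closed) = shattered v∈V ∉⊥ in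
            P ─ C , x∈p∧x∉q⇒x∈p─q v∈P v∉C
            , (λ x∈ → let (x∈P , x∉C) = ∈─⁻ P C x∈ in x∈p∧x∉q⇒x∈p─q (P⊆V x∈P) x∉C)
            , ≤-trans (∣p─q∣≤∣p∣ P C) P≤N
            , λ x∈ x~y y∈ _ → let (y∈V , y∉C) = ∈─⁻ V C y∈ in
                x∈p∧x∉q⇒x∈p─q (P-closed (p─q⊆p P C x∈) x~y y∈V ∉⊥) y∉C
        ... | R₁ , size₁ , shattered₁ | R₂ , size₂ , shattered₂ = R₁ ∪ R₂ , size , pieces
          where
          open ≤-Reasoning
          size : ∣ R₁ ∪ R₂ ∣ * b ≤ a * ∣ V ∣
          size = begin
            ∣ R₁ ∪ R₂ ∣ * b               ≤⟨ *-monoˡ-≤ b (∣p∪q∣≤∣p∣+∣q∣ R₁ R₂) ⟩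
            (∣ R₁ ∣ + ∣ R₂ ∣) * b         ≡⟨ *-distribʳ-+ b ∣ R₁ ∣ ∣ R₂ ∣ ⟩
            ∣ R₁ ∣ * b + ∣ R₂ ∣ * b       ≤⟨ +-mono-≤ size₁ size₂ ⟩
            a * ∣ C ∣ + a * ∣ V ─ C ∣     ≡⟨ ≡-sym (*-distribˡ-+ a ∣ C ∣ ∣ V ─ C ∣) ⟩
            a * (∣ C ∣ + ∣ V ─ C ∣)       ≤⟨ *-monoʳ-≤ a (∣q∣+∣p─q∣≤∣p∣ C⊆V) ⟩
            a * ∣ V ∣                     ∎
          pieces : Shattered V (R₁ ∪ R₂) K
          pieces {v} v∈V v∉R with v ∈? C
          ... | yes v∈C =
            let (P , v∈P , P⊆C , P≤K , P-closed) = shattered₁ v∈C (v∉R ∘ p⊆p∪q R₂) in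
            P , v∈P , C⊆V ∘ P⊆C , P≤K
            , λ x∈P x~y y∈V y∉R → P-closed x∈P x~y (C-closed (P⊆C x∈P) x~y y∈V ∉⊥) (y∉R ∘ p⊆p∪q R₂)
          ... | no v∉C =
            let (P , v∈P , P⊆ , P≤K , P-closed) = shattered₂ (x∈p∧x∉q⇒x∈p─q v∈V v∉C) (v∉R ∘ q⊆p∪q R₁ R₂) in
            P , v∈P , p─q⊆p V C ∘ P⊆ , P≤K
            , λ {x} {y} x∈P x~y y∈V y∉R → let (x∈V , x∉C) = ∈─⁻ V C (P⊆ x∈P) in
                P-closed x∈P x~y
                  (x∈p∧x∉q⇒x∈p─q y∈V λ y∈C → x∉C (C-closed y∈C (~-sym x~y) x∈V ∉⊥))
                  (y∉R ∘ q⊆p∪q R₁ R₂)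

      -- A set of at most N vertices needs no separator. A larger one can pay for it, because m * b
      -- ≤ c * N ≤ c * ∣ U ∣.
      decomposable-double : ∀ {N a b} m c → Decomposable N a b → m * b ≤ c * N →
        (∀ U → ∣ U ∣ ≤ 2 * N → ∃ λ Y → ∣ Y ∣ ≤ m × Shattered U Y N) →
        Decomposable (2 * N) (a + c) b
      decomposable-double {N} {a} {b} m c dec mb≤cN separate U U≤2N with ∣ U ∣ ≤? N
      ... | yes U≤N = let (R , size , shattered) = dec U U≤N in
            R , ≤-trans size (*-monoˡ-≤ ∣ U ∣ (m≤m+n a c)) , shattered
      ... | no U≰N with separate U U≤2N
      ... | Y , Y≤m , shattered with decompose-pieces {a = a} dec (U ─ Y) restricted
        where
        restricted : Shattered (U ─ Y) ⊥ N
        restricted {v} v∈ _ =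
          let (v∈U , v∉Y) = ∈─⁻ U Y v∈ ; (P , v∈P , P⊆U , P≤N , P-closed) = shattered v∈U v∉Y in
          P ─ Y , x∈p∧x∉q⇒x∈p─q v∈P v∉Y
          , (λ x∈ → let (x∈P , x∉Y) = ∈─⁻ P Y x∈ in x∈p∧x∉q⇒x∈p─q (P⊆U x∈P) x∉Y)
          , ≤-trans (∣p─q∣≤∣p∣ P Y) P≤N
          , λ x∈ x~y y∈ _ → let (y∈U , y∉Y) = ∈─⁻ U Y y∈ in
              x∈p∧x∉q⇒x∈p─q (P-closed (p─q⊆p P Y x∈) x~y y∈U y∉Y) y∉Y
      ... | R , size , pieces = Y ∪ R , size′ , pieces′
        where
        open ≤-Reasoning
        size′ : ∣ Y ∪ R ∣ * b ≤ (a + c) * ∣ U ∣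
        size′ = begin
          ∣ Y ∪ R ∣ * b               ≤⟨ *-monoˡ-≤ b (∣p∪q∣≤∣p∣+∣q∣ Y R) ⟩
          (∣ Y ∣ + ∣ R ∣) * b         ≡⟨ *-distribʳ-+ b ∣ Y ∣ ∣ R ∣ ⟩
          ∣ Y ∣ * b + ∣ R ∣ * b       ≤⟨ +-mono-≤ (≤-trans (*-monoˡ-≤ b Y≤m) mb≤cN) size ⟩
          c * N + a * ∣ U ─ Y ∣       ≤⟨ +-mono-≤ (*-monoʳ-≤ c (≰⇒≥ U≰N)) (*-monoʳ-≤ a (∣p─q∣≤∣p∣ U Y)) ⟩
          c * ∣ U ∣ + a * ∣ U ∣       ≡⟨ +-comm (c * ∣ U ∣) _ ⟩
          a * ∣ U ∣ + c * ∣ U ∣       ≡⟨ ≡-sym (*-distribʳ-+ ∣ U ∣ a c) ⟩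
          (a + c) * ∣ U ∣             ∎
        pieces′ : Shattered U (Y ∪ R) K
        pieces′ {v} v∈U v∉ =
          let (P , v∈P , P⊆ , P≤K , P-closed) = pieces (x∈p∧x∉q⇒x∈p─q v∈U (v∉ ∘ p⊆p∪q R)) (v∉ ∘ q⊆p∪q Y R) in
          P , v∈P , p─q⊆p U Y ∘ P⊆ , P≤K
          , λ x∈P x~y y∈U y∉ → P-closed x∈P x~y (x∈p∧x∉q⇒x∈p─q y∈U (y∉ ∘ p⊆p∪q R)) (y∉ ∘ q⊆p∪q Y R)

      module _ {r : ℕ} {H : Graph r} (minorFree : MinorFree G H) (r>0 : 0 < r) where

        private
          r≤r² : r ≤ r * r
          r≤r² = m≤m*n r r {{ℕ.>-nonZero r>0}}

          separator : ∀ {N} m → 0 < m → r * (2 * N) ≤ (2 * r * m) * (2 * r * m) →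
            ∀ U → ∣ U ∣ ≤ 2 * N → ∃ λ Y → ∣ Y ∣ ≤ r * (2 * r * m) × Shattered U Y N
          separator {N} m m>0 bound U U≤2N =
            Separator.separate N (2 * r * m) U r U≤2N (≤-trans (*-monoʳ-≤ r U≤2N) bound)
              (λ clique → minorFree (clique-minor clique H)) (*-mono-< {0} {2 * r} {0} (*-mono-< {0} {2} {0} (s≤s z≤n) r>0) m>0)

        -- Scales are squares m², so that their roots are exact; two doublings lead from m² to
        -- (2m)². Both use τ = 2rm and delete at most rτ = 2r²m vertices, which adds 2r² to the
        -- numerator over the denominator m. The final factor 2 changes the denominator to 2m.
        decomposable-quadruple : ∀ {a m} → 0 < m → Decomposable (m * m) a m →
          Decomposable ((2 * m) * (2 * m)) (2 * (a + 4 * (r * r))) (2 * m)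
        decomposable-quadruple {a} {m} m>0 dec U U≤ =
          let (R , size , shattered) = twice U (≤-trans U≤ (≤-reflexive (regroup m))) in
          R , scale ∣ R ∣ ∣ U ∣ size , shattered
          where
          open ≤-Reasoning
          regroup : ∀ m → (2 * m) * (2 * m) ≡ 2 * (2 * (m * m))
          regroup = solve-∀
          size-once : ∀ r m → r * (2 * r * m) * m ≡ 2 * (r * r) * (m * m)
          size-once = solve-∀
          expand : ∀ r m → (r * r) * (2 * (2 * (m * m))) ≡ (2 * r * m) * (2 * r * m)
          expand = solve-∀
          bound : r * (2 * (2 * (m * m))) ≤ (2 * r * m) * (2 * r * m)
          bound = ≤-trans (*-monoˡ-≤ (2 * (2 * (m * m))) r≤r²) (≤-reflexive (expand r m))
          once : Decomposable (2 * (m * m)) (a + 2 * (r * r)) m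
          once = decomposable-double {a = a} (r * (2 * r * m)) (2 * (r * r)) dec (≤-reflexive (size-once r m))
            (separator m m>0 (≤-trans (*-monoʳ-≤ r (m≤m+n (2 * (m * m)) _)) bound))
          twice : Decomposable (2 * (2 * (m * m))) (a + 2 * (r * r) + 2 * (r * r)) m
          twice = decomposable-double {a = a + 2 * (r * r)} (r * (2 * r * m)) (2 * (r * r)) once
            (≤-trans (≤-reflexive (size-once r m)) (*-monoʳ-≤ (2 * (r * r)) (m≤m+n (m * m) _)))
            (separator m m>0 bound)
          left : ∀ x m → x * (2 * m) ≡ 2 * (x * m)
          left = solve-∀
          right : ∀ a r u → 2 * ((a + 2 * (r * r) + 2 * (r * r)) * u) ≡ 2 * (a + 4 * (r * r)) * u
          right = solve-∀
          scale : ∀ x u → x * m ≤ (a + 2 * (r * r) + 2 * (r * r)) * u → x * (2 * m) ≤ 2 * (a + 4 * (r * r)) * u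
          scale x u le = begin
            x * (2 * m)                                        ≡⟨ left x m ⟩
            2 * (x * m)                                        ≤⟨ *-monoʳ-≤ 2 le ⟩
            2 * ((a + 2 * (r * r) + 2 * (r * r)) * u)          ≡⟨ right a r u ⟩
            2 * (a + 4 * (r * r)) * u                          ∎

    module _ {r : ℕ} {H : Graph r} (minorFree : MinorFree G H) (r>0 : 0 < r) (q : ℕ) (q>0 : 0 < q) where

      private
        scaled>0 : ∀ t → 0 < 2 ^ t * q
        scaled>0 t = *-mono-< {0} {2 ^ t} {0} (m^n>0 2 t) q>0

      -- Passing from scale m = 2^t q to 2m removes a fraction 4r²/m of the vertices; these form a
      -- geometric series with sum 8r²/q, of which a/m is the partial sum.
      decomposable : ∀ t → ∃ λ a → a + 8 * (r * r) ≡ 2 ^ t * (8 * (r * r)) ×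
        Decomposable (q * q) ((2 ^ t * q) * (2 ^ t * q)) a (2 ^ t * q)
      decomposable zero = 0 , ≡-sym (+-identityʳ _) , λ U U≤ →
        ⊥ , ≤-trans (≤-reflexive (cong (_* (1 * q)) (∣⊥∣≡0 n))) z≤n ,
        λ s∈U _ → U , s∈U , id , ≤-trans U≤ (≤-reflexive (cong₂ _*_ (*-identityˡ q) (*-identityˡ q))) , λ _ _ y∈U _ → y∈U
      decomposable (suc t) =
        let (a , a≡ , dec) = decomposable t in
        2 * (a + 4 * (r * r)) , step-≡ a (2 ^ t) a≡ ,
        subst (λ m → Decomposable (q * q) (m * m) (2 * (a + 4 * (r * r))) m) (≡-sym (*-assoc 2 (2 ^ t) q))
          (decomposable-quadruple (q * q) {H = H} minorFree r>0 {a = a} {m = 2 ^ t * q} (scaled>0 t) dec)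
        where
        left : ∀ a r → 2 * (a + 4 * (r * r)) + 8 * (r * r) ≡ 2 * (a + 8 * (r * r))
        left = solve-∀
        step-≡ : ∀ a p → a + 8 * (r * r) ≡ p * (8 * (r * r)) → 2 * (a + 4 * (r * r)) + 8 * (r * r) ≡ 2 * p * (8 * (r * r))
        step-≡ a p eq = trans (left a r) (trans (cong (2 *_) eq) (≡-sym (*-assoc 2 p _)))

      hyperfinite : ∃ λ R → ∣ R ∣ * q ≤ 8 * (r * r) * n × Shattered ⊤ R (q * q)
      hyperfinite =
        -- The number of scales is free, as the sum of the series does not depend on it; n of them
        -- reach the whole vertex set because n ≤ 2^n.
        let (a , a≡ , dec) = decomposable n
            (R , size , shattered) = dec ⊤ (≤-trans (≤-reflexive (∣⊤∣≡n n)) n≤)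
        in R , *-cancelˡ-≤ (2 ^ n) {{ℕ.>-nonZero (m^n>0 2 n)}} (bound ∣ R ∣ a size a≡) , shattered
        where
        open ≤-Reasoning
        n≤ : n ≤ (2 ^ n * q) * (2 ^ n * q)
        n≤ = begin
          n                          ≤⟨ n≤2^n n ⟩
          2 ^ n                      ≤⟨ m≤m*n (2 ^ n) q {{ℕ.>-nonZero q>0}} ⟩
          2 ^ n * q                  ≤⟨ m≤m*n (2 ^ n * q) (2 ^ n * q) {{ℕ.>-nonZero (scaled>0 n)}} ⟩
          (2 ^ n * q) * (2 ^ n * q)  ∎
          where
          n≤2^n : ∀ k → k ≤ 2 ^ k
          n≤2^n zero = z≤n
          n≤2^n (suc k) = begin
            suc k              ≤⟨ +-mono-≤ (m^n>0 2 k) (n≤2^n k) ⟩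
            2 ^ k + 2 ^ k      ≡⟨ cong (2 ^ k +_) (≡-sym (+-identityʳ (2 ^ k))) ⟩
            2 ^ suc k          ∎
        commute : ∀ x p q → p * (x * q) ≡ x * (p * q)
        commute = solve-∀
        bound : ∀ x a → x * (2 ^ n * q) ≤ a * ∣ ⊤ {n} ∣ → a + 8 * (r * r) ≡ 2 ^ n * (8 * (r * r)) →
          2 ^ n * (x * q) ≤ 2 ^ n * (8 * (r * r) * n)
        bound x a size a≡ = begin
          2 ^ n * (x * q)                ≡⟨ commute x (2 ^ n) q ⟩
          x * (2 ^ n * q)                ≤⟨ size ⟩
          a * ∣ ⊤ {n} ∣                  ≡⟨ cong (a *_) (∣⊤∣≡n n) ⟩
          a * n                          ≤⟨ *-monoˡ-≤ n (≤-trans (m≤m+n a _) (≤-reflexive a≡)) ⟩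
          2 ^ n * (8 * (r * r)) * n      ≡⟨ *-assoc (2 ^ n) _ n ⟩
          2 ^ n * (8 * (r * r) * n)      ∎

  -- Numerical conditions on ℓ

  module Bounds (r ℓ : ℕ) (r>0 : 0 < r) (48r³≤ℓ : 48 * r ^ 3 ≤ ℓ) where

    open ≤-Reasoning

    instance
      r≢0 : ℕ.NonZero r
      r≢0 = ℕ.>-nonZero r>0

    48r²≤ℓ : 48 * (r * r) ≤ ℓ
    48r²≤ℓ = begin
      48 * (r * r)        ≤⟨ *-monoʳ-≤ 48 (m≤m*n (r * r) r) ⟩
      48 * (r * r * r)    ≡⟨ cong (48 *_) (cube r) ⟩
      48 * r ^ 3          ≤⟨ 48r³≤ℓ ⟩
      ℓ                   ∎
      where
      cube : ∀ r → r * r * r ≡ r * (r * (r * 1))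
      cube = solve-∀

    48≤ℓ : 48 ≤ ℓ
    48≤ℓ = ≤-trans (m≤m*n 48 (r * r) {{m*n≢0 r r}}) 48r²≤ℓ

    instance
      ℓ≢0 : ℕ.NonZero ℓ
      ℓ≢0 = ℕ.>-nonZero (≤-trans (s≤s z≤n) 48≤ℓ)

    K-small : 3 * (ℓ ^ 3 * ℓ ^ 3) ≤ ℓ ^ 7
    K-small = begin
      3 * (ℓ ^ 3 * ℓ ^ 3)   ≡⟨ cong (3 *_) (≡-sym (^-distribˡ-+-* ℓ 3 3)) ⟩
      3 * ℓ ^ 6             ≤⟨ *-monoˡ-≤ (ℓ ^ 6) (≤-trans (m≤m+n 3 45) 48≤ℓ) ⟩
      ℓ ^ 7                 ∎

    -- The constant 48 is 3 · 8 · 2: the 3 of the claim, the 8 from the geometric series, and the 2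
    -- from 1 + ℓ ≤ 2ℓ. Together they give 24r²ℓ(ℓ + 1) ≤ 48r²ℓ² ≤ ℓ³.
    R-small : ∀ x n → x * ℓ ^ 3 ≤ 8 * (r * r) * n → 3 * (ℓ * suc ℓ) * x ≤ n
    R-small x n size = *-cancelˡ-≤ (8 * (r * r)) {{m*n≢0 8 (r * r) {{_}} {{m*n≢0 r r}}}} (begin
      8 * (r * r) * (3 * (ℓ * suc ℓ) * x)       ≡⟨ regroup₁ (r * r) ℓ x ⟩
      x * (24 * (r * r) * (ℓ * (1 + ℓ)))        ≤⟨ *-monoʳ-≤ x (*-monoʳ-≤ (24 * (r * r)) (*-monoʳ-≤ ℓ (+-monoˡ-≤ ℓ (≤-trans (s≤s z≤n) 48≤ℓ)))) ⟩
      x * (24 * (r * r) * (ℓ * (ℓ + ℓ)))        ≡⟨ regroup₂ (r * r) ℓ x ⟩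
      x * (48 * (r * r) * (ℓ * ℓ))              ≤⟨ *-monoʳ-≤ x (*-monoˡ-≤ (ℓ * ℓ) 48r²≤ℓ) ⟩
      x * (ℓ * (ℓ * ℓ))                         ≡⟨ regroup₃ ℓ x ⟩
      x * ℓ ^ 3                                 ≤⟨ size ⟩
      8 * (r * r) * n                           ∎)
      where
      regroup₁ : ∀ s ℓ x → 8 * s * (3 * (ℓ * (1 + ℓ)) * x) ≡ x * (24 * s * (ℓ * (1 + ℓ)))
      regroup₁ = solve-∀
      regroup₂ : ∀ s ℓ x → x * (24 * s * (ℓ * (ℓ + ℓ))) ≡ x * (48 * s * (ℓ * ℓ))
      regroup₂ = solve-∀
      regroup₃ : ∀ ℓ x → x * (ℓ * (ℓ * ℓ)) ≡ x * (ℓ * (ℓ * (ℓ * 1)))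
      regroup₃ = solve-∀

-- Expectations of finite distributions

module Expectation where

  open import Level using (Level)
  open import Data.Bool using (Bool; true; false; if_then_else_; not)
  open import Data.Nat as ℕ using (ℕ; zero; suc; NonZero)
  import Data.Nat.Properties as ℕₚ
  open import Data.Integer as ℤ using (+_)
  import Data.Integer.Properties as ℤₚ
  open import Data.Rational as ℚ using (ℚ; 0ℚ; 1ℚ; ½; _+_; _*_; _-_; -_; _≤_; _/_; toℚᵘ)
  open import Data.Rational.Properties as ℚₚ
  import Data.Rational.Unnormalised as ℚᵘ
  import Data.Rational.Unnormalised.Properties as ℚᵘₚ
  open import Data.Rational.Unnormalised using (mkℚᵘ; *≡*)
  open import Algebra using (CommutativeRing)
  open import Algebra.Properties.Semiring.Sum (CommutativeRing.semiring ℚₚ.+-*-commutativeRing) using (∑-distrib-+; ∑-comm; *-distribˡ-sum; *-distribʳ-sum; sum-cong-≗) renaming (sum to ∑)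
  open import Data.Fin using (Fin; zero; suc)
  open import Data.List using (List; []; _∷_; map; filterᵇ; length; _++_; concatMap; tabulate)
  open import Data.Maybe using (Maybe; nothing; just)
  open import Data.Product using (_×_; _,_)
  open import Data.Sum using (_⊎_; inj₁; inj₂)
  open import Function using (_∘_; id)
  open import Relation.Nullary using (yes; no)
  open import Relation.Binary.PropositionalEquality using (_≡_; refl; cong; cong₂; subst; subst₂; trans; module ≡-Reasoning) renaming (sym to ≡-sym)
  open import Tactic.RingSolver using (solve-∀)
  open import Tactic.RingSolver.Core.AlmostCommutativeRing using (AlmostCommutativeRing; fromCommutativeRing)
  import Data.Integer.Tactic.RingSolver as ℤ-Solver

  private variable
    a b : Level
    A B : Set a

  ℚ-ring : AlmostCommutativeRing _ _
  ℚ-ring = fromCommutativeRing ℚₚ.+-*-commutativeRing decide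
    where
    decide : ∀ x → Maybe (0ℚ ≡ x)
    decide x with 0ℚ ≟ x
    ... | yes p = just p
    ... | no _  = nothing

  -- The recursive embedding unfolds along with lengths and sums, so counting arguments avoid the
  -- normalised fractions of `_/_`.
  ι : ℕ → ℚ
  ι zero    = 0ℚ
  ι (suc k) = 1ℚ + ι k

  ι-+ : ∀ j k → ι (j ℕ.+ k) ≡ ι j + ι k
  ι-+ zero    k = ≡-sym (+-identityˡ _)
  ι-+ (suc j) k = trans (cong (λ z → 1ℚ + z) (ι-+ j k)) (≡-sym (+-assoc 1ℚ (ι j) (ι k)))

  ι-* : ∀ j k → ι (j ℕ.* k) ≡ ι j * ι k
  ι-* zero    k = ≡-sym (*-zeroˡ (ι k))
  ι-* (suc j) k = trans (ι-+ k _) (trans (cong (λ z → ι k + z) (ι-* j k)) (lemma (ι j) (ι k)))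
    where
    lemma : ∀ x y → y + x * y ≡ (1ℚ + x) * y
    lemma = solve-∀ ℚ-ring

  0≤1 : 0ℚ ≤ 1ℚ
  0≤1 = nonNegative⁻¹ 1ℚ

  0≤ι : ∀ k → 0ℚ ≤ ι k
  0≤ι zero    = ≤-refl
  0≤ι (suc k) = +-mono-≤ 0≤1 (0≤ι k)

  ι-mono : ∀ {j k} → j ℕ.≤ k → ι j ≤ ι k
  ι-mono {k = k} ℕ.z≤n = 0≤ι k
  ι-mono (ℕ.s≤s j≤k)   = +-monoʳ-≤ 1ℚ (ι-mono j≤k)

  *-monoˡ : ∀ {p q r} → 0ℚ ≤ r → p ≤ q → r * p ≤ r * q
  *-monoˡ {r = r} 0≤r = *-monoˡ-≤-nonNeg r {{ℚ.nonNegative 0≤r}}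

  *-monoʳ : ∀ {p q r} → 0ℚ ≤ r → p ≤ q → p * r ≤ q * r
  *-monoʳ {r = r} 0≤r = *-monoʳ-≤-nonNeg r {{ℚ.nonNegative 0≤r}}

  0≤* : ∀ {p q} → 0ℚ ≤ p → 0ℚ ≤ q → 0ℚ ≤ p * q
  0≤* {p} 0≤p 0≤q = subst (_≤ p * _) (*-zeroʳ p) (*-monoˡ 0≤p 0≤q)

  toℚᵘ-/ : ∀ k d → toℚᵘ (+ k / suc d) ℚᵘ.≃ mkℚᵘ (+ k) d
  toℚᵘ-/ k d = toℚᵘ-fromℚᵘ (mkℚᵘ (+ k) d)

  /-suc : ∀ k d .{{_ : NonZero d}} → + suc k / d ≡ + 1 / d + + k / d
  /-suc k (suc d) = toℚᵘ-injective (begin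
    toℚᵘ (+ suc k / suc d)                      ≈⟨ toℚᵘ-/ (suc k) d ⟩
    mkℚᵘ (+ suc k) d                            ≈⟨ *≡* (lemma (+ k) (+ suc d)) ⟩
    mkℚᵘ (+ 1) d ℚᵘ.+ mkℚᵘ (+ k) d              ≈⟨ ℚᵘₚ.+-cong (ℚᵘₚ.≃-sym {toℚᵘ (+ 1 / suc d)} (toℚᵘ-/ 1 d)) (ℚᵘₚ.≃-sym {toℚᵘ (+ k / suc d)} (toℚᵘ-/ k d)) ⟩
    toℚᵘ (+ 1 / suc d) ℚᵘ.+ toℚᵘ (+ k / suc d)  ≈⟨ ℚᵘₚ.≃-sym {toℚᵘ (+ 1 / suc d + + k / suc d)} (toℚᵘ-homo-+ (+ 1 / suc d) (+ k / suc d)) ⟩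
    toℚᵘ (+ 1 / suc d + + k / suc d)            ∎)
    where
    open ℚᵘₚ.≃-Reasoning
    lemma : ∀ k d → (ℤ.1ℤ ℤ.+ k) ℤ.* (d ℤ.* d) ≡ (ℤ.1ℤ ℤ.* d ℤ.+ k ℤ.* d) ℤ.* d
    lemma = ℤ-Solver.solve-∀

  /≡ι* : ∀ k d .{{_ : NonZero d}} → + k / d ≡ ι k * (+ 1 / d)
  /≡ι* zero    d = trans (0/n≡0 d) (≡-sym (*-zeroˡ (+ 1 / d)))
  /≡ι* (suc k) d = trans (/-suc k d) (trans (cong (λ z → + 1 / d + z) (/≡ι* k d)) (lemma (ι k) (+ 1 / d)))
    where
    lemma : ∀ x y → y + x * y ≡ (1ℚ + x) * y
    lemma = solve-∀ ℚ-ring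

  n/n≡1 : ∀ d .{{_ : NonZero d}} → + d / d ≡ 1ℚ
  n/n≡1 (suc d) = toℚᵘ-injective {+ suc d / suc d} {1ℚ} (ℚᵘₚ.≃-trans (toℚᵘ-/ (suc d) d) (*≡* (ℤₚ.*-comm (+ suc d) ℤ.1ℤ)))

  ι*1/ : ∀ d .{{_ : NonZero d}} → ι d * (+ 1 / d) ≡ 1ℚ
  ι*1/ d = trans (≡-sym (/≡ι* d d)) (n/n≡1 d)

  0≤1/ : ∀ d .{{_ : NonZero d}} → 0ℚ ≤ + 1 / d
  0≤1/ d = nonNegative⁻¹ (+ 1 / d) {{normalize-nonNeg 1 d}}

  ∑-mono : ∀ {n} {f g : Fin n → ℚ} → (∀ i → f i ≤ g i) → ∑ f ≤ ∑ g
  ∑-mono {zero}  f≤g = ≤-refl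
  ∑-mono {suc n} f≤g = +-mono-≤ (f≤g zero) (∑-mono (f≤g ∘ suc))

  ind : Bool → ℚ
  ind b = if b then 1ℚ else 0ℚ

  0≤ind : ∀ b → 0ℚ ≤ ind b
  0≤ind true  = 0≤1
  0≤ind false = ≤-refl

  ind≤1 : ∀ b → ind b ≤ 1ℚ
  ind≤1 true  = ≤-refl
  ind≤1 false = 0≤1

  sumOver : (A → ℚ) → List A → ℚ
  sumOver f []       = 0ℚ
  sumOver f (x ∷ xs) = f x + sumOver f xs

  sumOver-cong : {f g : A → ℚ} → (∀ x → f x ≡ g x) → ∀ xs → sumOver f xs ≡ sumOver g xs
  sumOver-cong eq []       = refl
  sumOver-cong eq (x ∷ xs) = cong₂ _+_ (eq x) (sumOver-cong eq xs)

  ι-length-filterᵇ : (p : A → Bool) → ∀ xs → ι (length (filterᵇ p xs)) ≡ sumOver (ind ∘ p) xs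
  ι-length-filterᵇ p [] = refl
  ι-length-filterᵇ p (x ∷ xs) with p x
  ... | true  = cong (λ z → 1ℚ + z) (ι-length-filterᵇ p xs)
  ... | false = trans (ι-length-filterᵇ p xs) (≡-sym (+-identityˡ _))

  E : Dist A → (A → ℚ) → ℚ
  E []            f = 0ℚ
  E ((p , x) ∷ d) f = p * f x + E d f

  weightOf≡E : (d : Dist A) (f : A → Bool) → weightOf d f ≡ E d (ind ∘ f)
  weightOf≡E [] f = refl
  weightOf≡E ((p , x) ∷ d) f with f x
  ... | true  = cong₂ _+_ (≡-sym (*-identityʳ p)) (weightOf≡E d f)
  ... | false = trans (weightOf≡E d f) (trans (≡-sym (+-identityˡ _)) (cong (_+ E d (ind ∘ f)) (≡-sym (*-zeroʳ p))))

  E-cong : (d : Dist A) {f g : A → ℚ} → (∀ x → f x ≡ g x) → E d f ≡ E d g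
  E-cong []            eq = refl
  E-cong ((p , x) ∷ d) eq = cong₂ _+_ (cong (p *_) (eq x)) (E-cong d eq)

  E-+ : (d : Dist A) (f g : A → ℚ) → E d (λ x → f x + g x) ≡ E d f + E d g
  E-+ []            f g = refl
  E-+ ((p , x) ∷ d) f g = trans (cong (λ z → p * (f x + g x) + z) (E-+ d f g)) (lemma p (f x) (g x) (E d f) (E d g))
    where
    lemma : ∀ p u v s t → p * (u + v) + (s + t) ≡ (p * u + s) + (p * v + t)
    lemma = solve-∀ ℚ-ring

  E-* : (d : Dist A) (c : ℚ) (f : A → ℚ) → E d (λ x → c * f x) ≡ c * E d f
  E-* []            c f = ≡-sym (*-zeroʳ c)
  E-* ((p , x) ∷ d) c f = trans (cong (λ z → p * (c * f x) + z) (E-* d c f)) (lemma p c (f x) (E d f))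
    where
    lemma : ∀ p c u s → p * (c * u) + c * s ≡ c * (p * u + s)
    lemma = solve-∀ ℚ-ring

  E-++ : (d e : Dist A) (f : A → ℚ) → E (d ++ e) f ≡ E d f + E e f
  E-++ []            e f = ≡-sym (+-identityˡ _)
  E-++ ((p , x) ∷ d) e f = trans (cong (λ z → p * f x + z) (E-++ d e f)) (≡-sym (+-assoc (p * f x) _ _))

  -- The scaling map of bindD is abstracted because pattern lambdas are not comparable.
  E-scale : (p : ℚ) (d : Dist A) (f : A → ℚ) (h : ℚ × A → ℚ × A) → (∀ q x → h (q , x) ≡ (p * q , x)) →
    E (map h d) f ≡ p * E d f
  E-scale p []            f h h≡ = ≡-sym (*-zeroʳ p)
  E-scale p ((q , x) ∷ d) f h h≡ rewrite h≡ q x =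
    trans (cong (λ z → p * q * f x + z) (E-scale p d f h h≡)) (lemma p q (f x) (E d f))
    where
    lemma : ∀ p q u s → p * q * u + p * s ≡ p * (q * u + s)
    lemma = solve-∀ ℚ-ring

  E-pure : (x : A) (f : A → ℚ) → E (pureD x) f ≡ f x
  E-pure x f = trans (+-identityʳ _) (*-identityˡ _)

  E-concatMap : (k : A → Dist B) (f : B → ℚ) (d : Dist A) (h : ℚ × A → Dist B) →
    (∀ p x → E (h (p , x)) f ≡ p * E (k x) f) → E (concatMap h d) f ≡ E d (λ x → E (k x) f)
  E-concatMap k f []            h h≡ = refl
  E-concatMap k f ((p , x) ∷ d) h h≡ = trans (E-++ (h (p , x)) (concatMap h d) f) (cong₂ _+_ (h≡ p x) (E-concatMap k f d h h≡))

  E-bind : (d : Dist A) (k : A → Dist B) (f : B → ℚ) → E (bindD d k) f ≡ E d (λ x → E (k x) f)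
  E-bind d k f = E-concatMap k f d _ λ p x → E-scale p (k x) f _ λ _ _ → refl

  E-weighted : ∀ {n} (c : ℚ) (φ : Fin n → A) (f : A → ℚ) → E (map (λ x → c , x) (tabulate φ)) f ≡ c * ∑ (f ∘ φ)
  E-weighted {n = zero}  c φ f = ≡-sym (*-zeroʳ c)
  E-weighted {n = suc n} c φ f = trans (cong (λ z → c * f (φ zero) + z) (E-weighted c (φ ∘ suc) f)) (≡-sym (*-distribˡ-+ c _ _))

  E-weighted-filter : ∀ {n} (c : ℚ) (p : A → Bool) (φ : Fin n → A) (f : A → ℚ) →
    E (map (λ x → c , x) (filterᵇ p (tabulate φ))) f ≡ c * ∑ (λ i → ind (p (φ i)) * f (φ i))
  E-weighted-filter {n = zero}  c p φ f = ≡-sym (*-zeroʳ c)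
  E-weighted-filter {n = suc n} c p φ f with p (φ zero)
  ... | true  = trans (cong (λ z → c * f (φ zero) + z) (E-weighted-filter c p (φ ∘ suc) f)) (lemma c (f (φ zero)) _)
    where
    lemma : ∀ c u s → c * u + c * s ≡ c * (1ℚ * u + s)
    lemma = solve-∀ ℚ-ring
  ... | false = trans (E-weighted-filter c p (φ ∘ suc) f) (cong (c *_) (≡-sym (trans (cong (_+ rest) (*-zeroˡ (f (φ zero)))) (+-identityˡ rest))))
    where
    rest : ℚ
    rest = ∑ (λ i → ind (p (φ (suc i))) * f (φ (suc i)))

  ι-length-filterᵇ-tabulate : ∀ {n} (p : A → Bool) (φ : Fin n → A) → ι (length (filterᵇ p (tabulate φ))) ≡ ∑ (ind ∘ p ∘ φ)
  ι-length-filterᵇ-tabulate {n = zero}  p φ = refl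
  ι-length-filterᵇ-tabulate {n = suc n} p φ with p (φ zero)
  ... | true  = cong (λ z → 1ℚ + z) (ι-length-filterᵇ-tabulate p (φ ∘ suc))
  ... | false = trans (ι-length-filterᵇ-tabulate p (φ ∘ suc)) (≡-sym (+-identityˡ _))

  -- Monotonicity of the expectation stands in for nonnegative weights: it passes through `bindD`
  -- without a look at the list of outcomes.
  record IsProbability {A : Set a} (d : Dist A) : Set a where
    field
      mono : ∀ {f g : A → ℚ} → (∀ x → f x ≤ g x) → E d f ≤ E d g
      mass : E d (λ _ → 1ℚ) ≡ 1ℚ

    E-const : ∀ c → E d (λ _ → c) ≡ c
    E-const c = begin
      E d (λ _ → c)         ≡⟨ E-cong d (λ _ → ≡-sym (*-identityʳ c)) ⟩
      E d (λ _ → c * 1ℚ)    ≡⟨ E-* d c (λ _ → 1ℚ) ⟩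
      c * E d (λ _ → 1ℚ)    ≡⟨ cong (c *_) mass ⟩
      c * 1ℚ                ≡⟨ *-identityʳ c ⟩
      c                     ∎
      where open ≡-Reasoning

    E≤ : ∀ {f c} → (∀ x → f x ≤ c) → E d f ≤ c
    E≤ {c = c} f≤c = subst (E d _ ≤_) (E-const c) (mono f≤c)

    0≤E : ∀ {f} → (∀ x → 0ℚ ≤ f x) → 0ℚ ≤ E d f
    0≤E 0≤f = subst (_≤ E d _) (E-const 0ℚ) (mono 0≤f)

  open IsProbability

  prob-pure : (x : A) → IsProbability (pureD x)
  prob-pure x .mono {f} {g} f≤g = subst₂ _≤_ (≡-sym (E-pure x f)) (≡-sym (E-pure x g)) (f≤g x)
  prob-pure x .mass = E-pure x (λ _ → 1ℚ)

  prob-bind : {d : Dist A} {k : A → Dist B} → IsProbability d → (∀ x → IsProbability (k x)) → IsProbability (bindD d k)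
  prob-bind {d = d} {k} P Q .mono {f} {g} f≤g =
    subst₂ _≤_ (≡-sym (E-bind d k f)) (≡-sym (E-bind d k g)) (mono P λ x → mono (Q x) f≤g)
  prob-bind {d = d} {k} P Q .mass = trans (E-bind d k _) (trans (E-cong d λ x → mass (Q x)) (mass P))

  prob-replicate : {d : Dist A} → IsProbability d → ∀ k → IsProbability (replicateD k d)
  prob-replicate P zero    = prob-pure []
  prob-replicate P (suc k) = prob-bind P λ x → prob-bind (prob-replicate P k) λ xs → prob-pure (x ∷ xs)

  prob-mapD : {f : A → Dist B} → (∀ x → IsProbability (f x)) → ∀ xs → IsProbability (mapD f xs)
  prob-mapD P []       = prob-pure []
  prob-mapD P (x ∷ xs) = prob-bind (P x) λ y → prob-bind (prob-mapD P xs) λ ys → prob-pure (y ∷ ys)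

  E-cons : (d : Dist A) (e : Dist (List A)) (f : List A → ℚ) →
    E (bindD d λ x → bindD e λ xs → pureD (x ∷ xs)) f ≡ E d (λ x → E e (λ xs → f (x ∷ xs)))
  E-cons d e f = trans (E-bind d (λ x → bindD e λ xs → pureD (x ∷ xs)) f) (E-cong d λ x → trans (E-bind e (λ xs → pureD (x ∷ xs)) f) (E-cong e λ xs → E-pure (x ∷ xs) f))

  E-cons-sumOver : {d : Dist A} {e : Dist (List A)} → IsProbability d → IsProbability e → (f : A → ℚ) →
    E (bindD d λ x → bindD e λ xs → pureD (x ∷ xs)) (sumOver f) ≡ E d f + E e (sumOver f)
  E-cons-sumOver {d = d} {e} P Q f = begin
    E (bindD d λ x → bindD e λ xs → pureD (x ∷ xs)) (sumOver f)  ≡⟨ E-cons d e (sumOver f) ⟩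
    E d (λ x → E e (λ xs → f x + sumOver f xs))                  ≡⟨ E-cong d (λ x → trans (E-+ e (λ _ → f x) (sumOver f)) (cong (_+ E e (sumOver f)) (E-const Q (f x)))) ⟩
    E d (λ x → f x + E e (sumOver f))                            ≡⟨ E-+ d f (λ _ → E e (sumOver f)) ⟩
    E d f + E d (λ _ → E e (sumOver f))                          ≡⟨ cong (λ z → E d f + z) (E-const P _) ⟩
    E d f + E e (sumOver f)                                      ∎
    where open ≡-Reasoning

  E-replicate-sumOver : {d : Dist A} → IsProbability d → ∀ k (f : A → ℚ) → E (replicateD k d) (sumOver f) ≡ ι k * E d f
  E-replicate-sumOver {d = d} P zero    f = trans (E-pure [] (sumOver f)) (≡-sym (*-zeroˡ (E d f)))
  E-replicate-sumOver {d = d} P (suc k) f = begin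
    E (replicateD (suc k) d) (sumOver f)      ≡⟨ E-cons-sumOver P (prob-replicate P k) f ⟩
    E d f + E (replicateD k d) (sumOver f)    ≡⟨ cong (λ z → E d f + z) (E-replicate-sumOver P k f) ⟩
    E d f + ι k * E d f                       ≡⟨ lemma (E d f) (ι k) ⟩
    (1ℚ + ι k) * E d f                        ∎
    where
    open ≡-Reasoning
    lemma : ∀ y x → y + x * y ≡ (1ℚ + x) * y
    lemma = solve-∀ ℚ-ring

  E-mapD-sumOver : {f : A → Dist B} → (∀ x → IsProbability (f x)) → (g : B → ℚ) → ∀ xs →
    E (mapD f xs) (sumOver g) ≡ sumOver (λ x → E (f x) g) xs
  E-mapD-sumOver P g []       = E-pure [] (sumOver g)
  E-mapD-sumOver {f = f} P g (x ∷ xs) =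
    trans (E-cons-sumOver (P x) (prob-mapD P xs) g) (cong (λ z → E (f x) g + z) (E-mapD-sumOver P g xs))

  -- Plain monotonicity asks for the inequality on all lists. The estimate for LOW answers holds
  -- only for lists of exactly `w` endpoints, so the length has to be tracked.
  replicate-mono : {d : Dist A} → IsProbability d → ∀ k {f g : List A → ℚ} →
    (∀ xs → length xs ≡ k → f xs ≤ g xs) → E (replicateD k d) f ≤ E (replicateD k d) g
  replicate-mono P zero {f} {g} f≤g = subst₂ _≤_ (≡-sym (E-pure [] f)) (≡-sym (E-pure [] g)) (f≤g [] refl)
  replicate-mono {d = d} P (suc k) {f} {g} f≤g =
    subst₂ _≤_ (≡-sym (E-cons d (replicateD k d) f)) (≡-sym (E-cons d (replicateD k d) g))
      (mono P λ x → replicate-mono P k λ xs len → f≤g (x ∷ xs) (cong suc len))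

  module _ (n : ℕ) .{{_ : NonZero n}} where

    E-uniform : (f : Fin n → ℚ) → E (uniform n) f ≡ (+ 1 / n) * ∑ f
    E-uniform = E-weighted (+ 1 / n) id

    prob-uniform : IsProbability (uniform n)
    prob-uniform .mono {f} {g} f≤g = subst₂ _≤_ (≡-sym (E-uniform f)) (≡-sym (E-uniform g)) (*-monoˡ (0≤1/ n) (∑-mono f≤g))
    prob-uniform .mass = trans (E-uniform (λ _ → 1ℚ)) (trans (*-comm (+ 1 / n) _) (trans (cong (_* (+ 1 / n)) (≡-sym (ι≡∑1 n))) (ι*1/ n)))
      where
      ι≡∑1 : ∀ k → ι k ≡ ∑ {k} (λ _ → 1ℚ)
      ι≡∑1 zero    = refl
      ι≡∑1 (suc k) = cong (λ z → 1ℚ + z) (ι≡∑1 k)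

  -- Lazy random walk: stationarity, hitting and escape

  module LazyWalk {n : ℕ} (G : Graph n) (d : ℕ) .{{_ : NonZero d}} (maxDegree : MaxDegree≤ G d) where

    open Walk G d

    deg : Fin n → ℚ
    deg v = ∑ (λ u → ind (adj G v u))

    ι-degree : ∀ v → ι (degree G v) ≡ deg v
    ι-degree v = ι-length-filterᵇ-tabulate (adj G v) id

    0≤moveP : 0ℚ ≤ moveP
    0≤moveP = 0≤* (0≤1/ d) (nonNegative⁻¹ ½)

    stay : Fin n → ℚ
    stay v = 1ℚ - deg v * moveP

    E-lazyStep : ∀ v (f : Fin n → ℚ) → E (lazyStep v) f ≡ stay v * f v + moveP * ∑ (λ u → ind (adj G v u) * f u)
    E-lazyStep v f = cong₂ _+_ (cong (λ p → (1ℚ - p) * f v) stay≡) (E-weighted-filter moveP (adj G v) id f)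
      where
      stay≡ : (+ degree G v / d) * ½ ≡ deg v * moveP
      stay≡ = trans (cong (_* ½) (trans (/≡ι* (degree G v) d) (cong (_* (+ 1 / d)) (ι-degree v)))) (*-assoc (deg v) (+ 1 / d) ½)

    -- Here the degree bound enters: it makes the probability of moving at most ½.
    0≤stay : ∀ v → 0ℚ ≤ stay v
    0≤stay v = subst (_≤ stay v) (+-inverseʳ 1ℚ) (+-monoʳ-≤ 1ℚ (neg-antimono-≤ (begin
      deg v * moveP               ≡⟨ cong (_* moveP) (≡-sym (ι-degree v)) ⟩
      ι (degree G v) * moveP      ≤⟨ *-monoʳ 0≤moveP (ι-mono (maxDegree v)) ⟩
      ι d * ((+ 1 / d) * ½)       ≡⟨ ≡-sym (*-assoc (ι d) (+ 1 / d) ½) ⟩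
      ι d * (+ 1 / d) * ½         ≡⟨ cong (_* ½) (ι*1/ d) ⟩
      1ℚ * ½                      ≤⟨ *-monoˡ 0≤1 ½≤1 ⟩
      1ℚ * 1ℚ                     ≡⟨⟩
      1ℚ                          ∎)))
      where
      open ≤-Reasoning
      ½≤1 : ½ ≤ 1ℚ
      ½≤1 = ≤ᵇ⇒≤ _

    -- Comparison on the support of the step is enough. The induction for `escape≤hit` requires
    -- this, since its hypothesis says nothing about vertices outside γ and ρ.
    lazyStep-mono : ∀ v {f g : Fin n → ℚ} → f v ≤ g v → (∀ u → adj G v u ≡ true → f u ≤ g u) → E (lazyStep v) f ≤ E (lazyStep v) g
    lazyStep-mono v {f} {g} at-v at-neighbours = subst₂ _≤_ (≡-sym (E-lazyStep v f)) (≡-sym (E-lazyStep v g))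
      (+-mono-≤ (*-monoˡ (0≤stay v) at-v) (*-monoˡ 0≤moveP (∑-mono λ u → term u (adj G v u) refl)))
      where
      term : ∀ u b → adj G v u ≡ b → ind b * f u ≤ ind b * g u
      term u true  v~u = *-monoˡ 0≤1 (at-neighbours u v~u)
      term u false _   = ≤-reflexive (trans (*-zeroˡ (f u)) (≡-sym (*-zeroˡ (g u))))

    prob-lazyStep : ∀ v → IsProbability (lazyStep v)
    prob-lazyStep v .mono f≤g = lazyStep-mono v (f≤g v) (λ u _ → f≤g u)
    prob-lazyStep v .mass = trans (E-lazyStep v (λ _ → 1ℚ))
      (trans (cong (λ s → stay v * 1ℚ + moveP * s) (sum-cong-≗ {n} (λ u → *-identityʳ (ind (adj G v u))))) (lemma (deg v) moveP))
      where
      lemma : ∀ D m → (1ℚ - D * m) * 1ℚ + m * D ≡ 1ℚ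
      lemma = solve-∀ ℚ-ring

    -- Adjacency is symmetric, so the uniform distribution is stationary.
    ∑-lazyStep : (f : Fin n → ℚ) → ∑ (λ v → E (lazyStep v) f) ≡ ∑ f
    ∑-lazyStep f = begin
      ∑ (λ v → E (lazyStep v) f)
        ≡⟨ sum-cong-≗ {n} (λ v → E-lazyStep v f) ⟩
      ∑ (λ v → stay v * f v + moveP * ∑ (λ u → ind (adj G v u) * f u))
        ≡⟨ ∑-distrib-+ {n} (λ v → stay v * f v) (λ v → moveP * ∑ (λ u → ind (adj G v u) * f u)) ⟩
      ∑ (λ v → stay v * f v) + ∑ (λ v → moveP * ∑ (λ u → ind (adj G v u) * f u))
        ≡⟨ cong (λ z → ∑ (λ v → stay v * f v) + z) incoming ⟩
      ∑ (λ v → stay v * f v) + ∑ (λ u → moveP * (deg u * f u))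
        ≡⟨ ≡-sym (∑-distrib-+ {n} (λ v → stay v * f v) (λ u → moveP * (deg u * f u))) ⟩
      ∑ (λ v → stay v * f v + moveP * (deg v * f v))
        ≡⟨ sum-cong-≗ {n} (λ v → lemma (deg v) moveP (f v)) ⟩
      ∑ f ∎
      where
      open ≡-Reasoning
      lemma : ∀ D m x → (1ℚ - D * m) * x + m * (D * x) ≡ x
      lemma = solve-∀ ℚ-ring
      incoming : ∑ (λ v → moveP * ∑ (λ u → ind (adj G v u) * f u)) ≡ ∑ (λ u → moveP * (deg u * f u))
      incoming = begin
        ∑ (λ v → moveP * ∑ (λ u → ind (adj G v u) * f u))  ≡⟨ ≡-sym (*-distribˡ-sum {n} moveP (λ v → ∑ (λ u → ind (adj G v u) * f u))) ⟩
        moveP * ∑ (λ v → ∑ (λ u → ind (adj G v u) * f u))  ≡⟨ cong (moveP *_) (∑-comm {n} {n} (λ v u → ind (adj G v u) * f u)) ⟩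
        moveP * ∑ (λ u → ∑ (λ v → ind (adj G v u) * f u))  ≡⟨ cong (moveP *_) (sum-cong-≗ {n} λ u → ≡-sym (trans (cong (_* f u) (sum-cong-≗ {n} λ v → cong ind (Defs.sym G u v))) (*-distribʳ-sum {n} (f u) (λ v → ind (adj G v u))))) ⟩
        moveP * ∑ (λ u → deg u * f u)                      ≡⟨ *-distribˡ-sum {n} moveP (λ u → deg u * f u) ⟩
        ∑ (λ u → moveP * (deg u * f u))                    ∎

    prob-walkEnd : ∀ L v → IsProbability (walkEnd L v)
    prob-walkEnd zero    v = prob-pure v
    prob-walkEnd (suc L) v = prob-bind (prob-lazyStep v) (prob-walkEnd L)

    prob-walk : ∀ L v → IsProbability (walk L v)
    prob-walk zero    v = prob-pure (v ∷ [])
    prob-walk (suc L) v = prob-bind (prob-lazyStep v) λ u → prob-bind (prob-walk L u) λ t → prob-pure (v ∷ t)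

    module Hitting (ρ : Fin n → Bool) where

      -- First-step recursion for the probability that a walk of `L` steps is in ρ at one of the
      -- times 0, ..., L.
      hit : ℕ → Fin n → ℚ
      hit zero    v = ind (ρ v)
      hit (suc L) v = if ρ v then 1ℚ else E (lazyStep v) (hit L)

      hit-ρ : ∀ L v → ρ v ≡ true → hit L v ≡ 1ℚ
      hit-ρ zero    v v∈ρ rewrite v∈ρ = refl
      hit-ρ (suc L) v v∈ρ rewrite v∈ρ = refl

      0≤hit : ∀ L v → 0ℚ ≤ hit L v
      0≤hit zero    v = 0≤ind (ρ v)
      0≤hit (suc L) v with ρ v
      ... | true  = 0≤1
      ... | false = 0≤E (prob-lazyStep v) (0≤hit L)

      hit-suc : ∀ L v → hit (suc L) v ≤ ind (ρ v) + E (lazyStep v) (hit L)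
      hit-suc L v with ρ v
      ... | true  = subst (_≤ 1ℚ + E (lazyStep v) (hit L)) (+-identityʳ 1ℚ) (+-monoʳ-≤ 1ℚ (0≤E (prob-lazyStep v) (0≤hit L)))
      ... | false = ≤-reflexive (≡-sym (+-identityˡ _))

      -- Union bound over the L + 1 times: from a uniform start the walk is uniform at each of them,
      -- by stationarity.
      ∑-hit : ∀ L → ∑ (hit L) ≤ ι (suc L) * ∑ (ind ∘ ρ)
      ∑-hit zero    = ≤-reflexive (≡-sym (*-identityˡ _))
      ∑-hit (suc L) = begin
        ∑ (hit (suc L))                                       ≤⟨ ∑-mono (hit-suc L) ⟩
        ∑ (λ v → ind (ρ v) + E (lazyStep v) (hit L))          ≡⟨ ∑-distrib-+ {n} (ind ∘ ρ) (λ v → E (lazyStep v) (hit L)) ⟩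
        ∑ (ind ∘ ρ) + ∑ (λ v → E (lazyStep v) (hit L))        ≡⟨ cong (λ z → ∑ (ind ∘ ρ) + z) (∑-lazyStep (hit L)) ⟩
        ∑ (ind ∘ ρ) + ∑ (hit L)                               ≤⟨ +-monoʳ-≤ (∑ (ind ∘ ρ)) (∑-hit L) ⟩
        ∑ (ind ∘ ρ) + ι (suc L) * ∑ (ind ∘ ρ)                 ≡⟨ lemma (∑ (ind ∘ ρ)) (ι (suc L)) ⟩
        (1ℚ + ι (suc L)) * ∑ (ind ∘ ρ)                        ∎
        where
        open ≤-Reasoning
        lemma : ∀ y x → y + x * y ≡ (1ℚ + x) * y
        lemma = solve-∀ ℚ-ring

      module _ (γ : Fin n → Bool) (γ-closed : ∀ {u v} → γ u ≡ true → adj G u v ≡ true → γ v ≡ true ⊎ ρ v ≡ true) where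

        -- A step from γ stays in γ or enters ρ, so a walk from there that ends outside γ has met ρ.
        -- In ρ the right side is 1; elsewhere both sides unfold by their first step.
        escape≤hit : ∀ L v → γ v ≡ true ⊎ ρ v ≡ true → E (walkEnd L v) (ind ∘ not ∘ γ) ≤ hit L v
        escape≤hit L v (inj₂ v∈ρ) = subst (E (walkEnd L v) (ind ∘ not ∘ γ) ≤_) (≡-sym (hit-ρ L v v∈ρ))
          (E≤ (prob-walkEnd L v) (ind≤1 ∘ not ∘ γ))
        escape≤hit zero v (inj₁ v∈γ) = subst (_≤ ind (ρ v)) (≡-sym (trans (E-pure v (ind ∘ not ∘ γ)) (cong (ind ∘ not) v∈γ))) (0≤ind (ρ v))
        escape≤hit (suc L) v (inj₁ v∈γ) with ρ v in eq
        ... | true  = E≤ (prob-walkEnd (suc L) v) (ind≤1 ∘ not ∘ γ)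
        ... | false = subst (_≤ E (lazyStep v) (hit L)) (≡-sym (E-bind (lazyStep v) (walkEnd L) (ind ∘ not ∘ γ)))
          (lazyStep-mono v (escape≤hit L v (inj₁ v∈γ)) λ u v~u → escape≤hit L u (γ-closed v∈γ v~u))

-- Deterministic analysis of the clipping decision

module Clipping where

  open import Data.Bool using (Bool; true; false; if_then_else_; not)
  open import Data.Bool.Properties using (T-≡)
  open import Data.Nat using (ℕ; zero; suc; z≤n; _+_; _*_; _≤_; _<_; _≤ᵇ_)
  import Data.Nat.Properties as ℕₚ
  open import Algebra.Properties.Semiring.Sum ℕₚ.+-*-semiring using (∑-distrib-+; *-distribˡ-sum; *-distribʳ-sum; sum-cong-≗) renaming (sum to ∑)
  open import Data.Fin using (Fin; zero; suc)
  open import Data.Fin.Properties using () renaming (_≟_ to _≟ᶠ_)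
  open import Data.Fin.Subset using (Subset; inside; outside; ∣_∣)
  open import Data.Vec using ([]; _∷_; lookup)
  open import Data.List using (List; []; _∷_; map; filterᵇ; length; tabulate; allFin)
  open import Data.List.Properties using (map-tabulate)
  open import Data.Nat.ListAction using (sum)
  open import Function using (_∘_; id; Equivalence)
  open import Relation.Nullary using (does; contradiction)
  open import Relation.Binary.PropositionalEquality using (_≡_; refl; cong; cong₂; trans; module ≡-Reasoning) renaming (sym to ≡-sym)
  open import Data.Nat.Tactic.RingSolver using (solve-∀)

  open Hyperfiniteness using (∑-mono)

  bit : Bool → ℕ
  bit b = if b then 1 else 0

  length-filterᵇ-∷ : {A : Set} (p : A → Bool) (x : A) (xs : List A) →
    length (filterᵇ p (x ∷ xs)) ≡ bit (p x) + length (filterᵇ p xs)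
  length-filterᵇ-∷ p x xs with p x
  ... | true  = refl
  ... | false = refl

  sum-map-allFin : ∀ {n} (f : Fin n → ℕ) → sum (map f (allFin n)) ≡ ∑ f
  sum-map-allFin f = trans (cong sum (map-tabulate id f)) (sum-tabulate f)
    where
    sum-tabulate : ∀ {n} (f : Fin n → ℕ) → sum (tabulate f) ≡ ∑ f
    sum-tabulate {zero}  f = refl
    sum-tabulate {suc n} f = cong (f zero +_) (sum-tabulate (f ∘ suc))

  ∑-bit : ∀ {n} (C : Subset n) → ∑ (bit ∘ lookup C) ≡ ∣ C ∣
  ∑-bit []            = refl
  ∑-bit (inside  ∷ C) = cong suc (∑-bit C)
  ∑-bit (outside ∷ C) = ∑-bit C

  ∑-zero : ∀ {n} (f : Fin n → ℕ) → ∑ (λ v → f v * 0) ≡ 0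
  ∑-zero {zero}  f = refl
  ∑-zero {suc n} f = cong₂ _+_ (ℕₚ.*-zeroʳ (f zero)) (∑-zero (f ∘ suc))

  ∑-select : ∀ {n} (f : Fin n → ℕ) (e : Fin n) → ∑ (λ v → f v * bit (does (e ≟ᶠ v))) ≡ f e
  ∑-select {suc n} f zero    = trans (cong₂ _+_ (ℕₚ.*-identityʳ (f zero)) (∑-zero (f ∘ suc))) (ℕₚ.+-identityʳ (f zero))
  ∑-select {suc n} f (suc e) = cong₂ _+_ (ℕₚ.*-zeroʳ (f zero)) (∑-select (f ∘ suc) e)

  module Clip {n : ℕ} (C : Subset n) where

    count : List (Fin n) → Fin n → ℕ
    count ends v = length (filterᵇ (λ u → does (u ≟ᶠ v)) ends)

    outsideCount : List (Fin n) → ℕ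
    outsideCount ends = length (filterᵇ (not ∘ lookup C) ends)

    insideCount : List (Fin n) → ℕ
    insideCount ends = ∑ (λ v → bit (lookup C v) * count ends v)

    inside+outside : ∀ ends → insideCount ends + outsideCount ends ≡ length ends
    inside+outside [] = trans (ℕₚ.+-identityʳ _) (∑-zero (bit ∘ lookup C))
    inside+outside (e ∷ ends) = begin
      insideCount (e ∷ ends) + outsideCount (e ∷ ends)
        ≡⟨ cong₂ _+_ split (length-filterᵇ-∷ (not ∘ lookup C) e ends) ⟩
      (bit (lookup C e) + insideCount ends) + (bit (not (lookup C e)) + outsideCount ends)
        ≡⟨ swap (bit (lookup C e)) (insideCount ends) (bit (not (lookup C e))) (outsideCount ends) ⟩
      (bit (lookup C e) + bit (not (lookup C e))) + (insideCount ends + outsideCount ends)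
        ≡⟨ cong₂ _+_ (one (lookup C e)) (inside+outside ends) ⟩
      suc (length ends) ∎
      where
      open ≡-Reasoning
      swap : ∀ a b c d → (a + b) + (c + d) ≡ (a + c) + (b + d)
      swap = solve-∀
      one : ∀ b → bit b + bit (not b) ≡ 1
      one true  = refl
      one false = refl
      split : insideCount (e ∷ ends) ≡ bit (lookup C e) + insideCount ends
      split = begin
        ∑ (λ v → bit (lookup C v) * count (e ∷ ends) v)
          ≡⟨ sum-cong-≗ {n} (λ v → trans (cong (bit (lookup C v) *_) (length-filterᵇ-∷ (λ u → does (u ≟ᶠ v)) e ends)) (ℕₚ.*-distribˡ-+ (bit (lookup C v)) _ _)) ⟩
        ∑ (λ v → bit (lookup C v) * bit (does (e ≟ᶠ v)) + bit (lookup C v) * count ends v)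
          ≡⟨ ∑-distrib-+ {n} (λ v → bit (lookup C v) * bit (does (e ≟ᶠ v))) (λ v → bit (lookup C v) * count ends v) ⟩
        ∑ (λ v → bit (lookup C v) * bit (does (e ≟ᶠ v))) + insideCount ends
          ≡⟨ cong (_+ insideCount ends) (∑-select (bit ∘ lookup C) e) ⟩
        bit (lookup C e) + insideCount ends ∎

    clipped : ℕ → List (Fin n) → Fin n → ℕ
    clipped T ends v = if T ≤ᵇ (2 * count ends v) then count ends v else 0

    low⇒escapes : ∀ T w ends → length ends ≡ w → 3 * (∣ C ∣ * T) ≤ w → 3 * ∑ (clipped T ends) < w →
      w ≤ 2 * outsideCount ends
    low⇒escapes T w ends len small low = ℕₚ.+-cancelˡ-≤ (2 * insideCount ends) _ _ (begin
      2 * insideCount ends + w                          ≤⟨ ℕₚ.+-monoˡ-≤ w 2inside≤w ⟩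
      w + w                                             ≡⟨ double w ⟩
      2 * w                                             ≡⟨ cong (2 *_) (≡-sym (trans (inside+outside ends) len)) ⟩
      2 * (insideCount ends + outsideCount ends)        ≡⟨ ℕₚ.*-distribˡ-+ 2 (insideCount ends) _ ⟩
      2 * insideCount ends + 2 * outsideCount ends      ∎)
      where
      open ℕₚ.≤-Reasoning
      double : ∀ w → w + w ≡ 2 * w
      double = solve-∀
      -- The factor 6 clears both denominators, the half in the threshold T/2 and the third in the
      -- decision w/3.
      term : ∀ c g b → (b ≡ false → 2 * c < T) → 6 * (bit g * c) ≤ 6 * (if b then c else 0) + 3 * (bit g * T)
      term c true  true  _   = ℕₚ.≤-trans (ℕₚ.≤-reflexive (cong (6 *_) (ℕₚ.*-identityˡ c))) (ℕₚ.m≤m+n (6 * c) _)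
      term c false _     _   = z≤n
      term c true  false c<T = begin
        6 * (1 * c)    ≡⟨ regroup c ⟩
        3 * (2 * c)    ≤⟨ ℕₚ.*-monoʳ-≤ 3 (ℕₚ.<⇒≤ (c<T refl)) ⟩
        3 * T          ≡⟨ cong (3 *_) (≡-sym (ℕₚ.*-identityˡ T)) ⟩
        3 * (1 * T)    ∎
        where
        regroup : ∀ c → 6 * (1 * c) ≡ 3 * (2 * c)
        regroup = solve-∀
      below : ∀ c → (T ≤ᵇ (2 * c)) ≡ false → 2 * c < T
      below c eq = ℕₚ.≰⇒> λ T≤ → contradiction (trans (≡-sym eq) (Equivalence.to T-≡ (ℕₚ.≤⇒≤ᵇ T≤))) λ ()
      vertexwise : 6 * insideCount ends ≤ 6 * ∑ (clipped T ends) + 3 * (∣ C ∣ * T)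
      vertexwise = begin
        6 * insideCount ends
          ≡⟨ *-distribˡ-sum {n} 6 (λ v → bit (lookup C v) * count ends v) ⟩
        ∑ (λ v → 6 * (bit (lookup C v) * count ends v))
          ≤⟨ ∑-mono (λ v → term (count ends v) (lookup C v) _ (below (count ends v))) ⟩
        ∑ (λ v → 6 * clipped T ends v + 3 * (bit (lookup C v) * T))
          ≡⟨ ∑-distrib-+ {n} (λ v → 6 * clipped T ends v) (λ v → 3 * (bit (lookup C v) * T)) ⟩
        ∑ (λ v → 6 * clipped T ends v) + ∑ (λ v → 3 * (bit (lookup C v) * T))
          ≡⟨ cong₂ _+_ (≡-sym (*-distribˡ-sum {n} 6 (clipped T ends))) (≡-sym (*-distribˡ-sum {n} 3 (λ v → bit (lookup C v) * T))) ⟩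
        6 * ∑ (clipped T ends) + 3 * ∑ (λ v → bit (lookup C v) * T)
          ≡⟨ cong (λ z → 6 * ∑ (clipped T ends) + 3 * z) (trans (≡-sym (*-distribʳ-sum {n} T (bit ∘ lookup C))) (cong (_* T) (∑-bit C))) ⟩
        6 * ∑ (clipped T ends) + 3 * (∣ C ∣ * T) ∎
      2inside≤w : 2 * insideCount ends ≤ w
      2inside≤w = ℕₚ.*-cancelˡ-≤ 3 (begin
        3 * (2 * insideCount ends)                        ≡⟨ regroup₁ (insideCount ends) ⟩
        6 * insideCount ends                              ≤⟨ vertexwise ⟩
        6 * ∑ (clipped T ends) + 3 * (∣ C ∣ * T)  ≡⟨ cong (_+ 3 * (∣ C ∣ * T)) (regroup₂ (∑ (clipped T ends))) ⟩
        2 * (3 * ∑ (clipped T ends)) + 3 * (∣ C ∣ * T)  ≤⟨ ℕₚ.+-mono-≤ (ℕₚ.*-monoʳ-≤ 2 (ℕₚ.<⇒≤ low)) small ⟩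
        2 * w + w                                         ≡⟨ triple w ⟩
        3 * w                                             ∎)
        where
        regroup₁ : ∀ x → 3 * (2 * x) ≡ 6 * x
        regroup₁ = solve-∀
        regroup₂ : ∀ x → 6 * x ≡ 2 * (3 * x)
        regroup₂ = solve-∀
        triple : ∀ w → 2 * w + w ≡ 3 * w
        triple = solve-∀

-- Probability of LOW answers and of acceptance

module Acceptance where

  open import Data.Bool using (Bool; true; false; if_then_else_; not)
  open import Data.Bool.Properties using (T-≡)
  open import Data.Nat as ℕ using (ℕ; zero; suc; NonZero; _^_; z≤n; s≤s)
  import Data.Nat.Properties as ℕₚ
  open import Data.Integer as ℤ using (+_)
  open import Data.Rational as ℚ using (ℚ; 0ℚ; 1ℚ; _+_; _*_; _-_; -_; _≤_; _/_)
  open import Data.Rational.Properties as ℚₚ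
  open import Algebra using (CommutativeRing)
  open import Algebra.Properties.Semiring.Sum (CommutativeRing.semiring ℚₚ.+-*-commutativeRing) using (*-distribˡ-sum) renaming (sum to ∑)
  open import Data.Fin using (Fin)
  open import Data.Fin.Subset using (Subset; inside; outside; _∈_; ∣_∣; ⊤)
  open import Data.Fin.Subset.Properties using (_∈?_; ∈⊤)
  open import Data.Vec using ([]; _∷_; lookup)
  open import Data.Vec.Properties using (lookup⇒[]=; []=⇒lookup)
  open import Data.List using (List; []; _∷_; length)
  import Data.List.Relation.Unary.All as All
  open import Data.Product using (_×_; _,_; proj₁)
  open import Data.Sum using (_⊎_; inj₁; inj₂)
  open import Data.Unit using (tt)
  open import Function using (_∘_; Equivalence)
  open import Relation.Nullary using (yes; no; contradiction)
  open import Relation.Binary.PropositionalEquality using (_≡_; refl; cong; cong₂; subst; subst₂; trans; module ≡-Reasoning) renaming (sym to ≡-sym)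
  open import Tactic.RingSolver using (solve-∀)

  open Hyperfiniteness using (Shattered; ClosedIn)
  open Expectation
  open Clipping
  open IsProbability

  ∑-ind : ∀ {n} (C : Subset n) → ∑ (ind ∘ lookup C) ≡ ι ∣ C ∣
  ∑-ind []            = refl
  ∑-ind (inside  ∷ C) = cong (λ z → 1ℚ + z) (∑-ind C)
  ∑-ind (outside ∷ C) = trans (+-identityˡ _) (∑-ind C)

  module Run {n : ℕ} .{{_ : NonZero n}} (G : Graph n) (d : ℕ) .{{_ : NonZero d}} (maxDegree : MaxDegree≤ G d)
    (ℓ : ℕ) .{{_ : NonZero ℓ}} where

    open Walk G d
    open Alg ℓ
    open LazyWalk G d maxDegree

    isLow : Bool → Bool
    isLow h = if h then false else true

    low : Fin n → ℚ
    low s = E (EstClip s) (ind ∘ isLow)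

    prob-EstClip : ∀ s → IsProbability (EstClip s)
    prob-EstClip s = prob-bind (prob-replicate (prob-walkEnd ℓ s) (ℓ ^ 14)) λ ends → prob-pure (clipDecision ends)

    prob-LocalSearchWalks : ∀ s → IsProbability (LocalSearchWalks s)
    prob-LocalSearchWalks s = prob-bind (prob-replicate (prob-walk (ℓ ^ 11) s) (ℓ ^ 21)) λ ts → prob-pure _

    prob-perVertex : ∀ s → IsProbability (perVertex s)
    prob-perVertex s = prob-bind (prob-EstClip s) λ h → prob-bind (prob-LocalSearchWalks s) λ B → prob-pure (h , B)

    prob-run : IsProbability IsMinorFreeRun
    prob-run = prob-bind (prob-replicate (prob-uniform n) (ℓ ^ 21)) (prob-mapD prob-perVertex)

    low-perVertex : ∀ s → E (perVertex s) (ind ∘ isLow ∘ proj₁) ≡ low s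
    low-perVertex s = trans (E-bind (EstClip s) (λ h → bindD (LocalSearchWalks s) λ B → pureD (h , B)) _) (E-cong (EstClip s) λ h →
      trans (E-bind (LocalSearchWalks s) (λ B → pureD (h , B)) _)
        (trans (E-cong (LocalSearchWalks s) (λ B → E-pure (h , B) (ind ∘ isLow ∘ proj₁))) (E-const (prob-LocalSearchWalks s) (ind (isLow h)))))

    module _ (C : Subset n) (C-small : 3 ℕ.* ∣ C ∣ ℕ.≤ ℓ ^ 7) where

      open Clip C

      private
        w = ℓ ^ 14
        instance
          w≢0 : NonZero w
          w≢0 = ℕₚ.m^n≢0 ℓ 14

      clipDecision-low : ∀ ends → length ends ≡ w → clipDecision ends ≡ false → w ℕ.≤ 2 ℕ.* outsideCount ends
      clipDecision-low ends len eq = low⇒escapes (ℓ ^ 7) w ends len small (ℕₚ.≰⇒> λ w≤ →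
        contradiction (trans (≡-sym eq) (Equivalence.to T-≡ (ℕₚ.≤⇒≤ᵇ (subst (λ z → w ℕ.≤ 3 ℕ.* z) (≡-sym (sum-map-allFin (clipped (ℓ ^ 7) ends))) w≤)))) λ ())
        where
        small : 3 ℕ.* (∣ C ∣ ℕ.* ℓ ^ 7) ℕ.≤ w
        small = subst₂ ℕ._≤_ (ℕₚ.*-assoc 3 ∣ C ∣ (ℓ ^ 7)) (≡-sym (ℕₚ.^-distribˡ-+-* ℓ 7 7)) (ℕₚ.*-monoˡ-≤ (ℓ ^ 7) C-small)

      -- Markov's inequality in pointwise form: the indicator of LOW is at most 2/w times the number
      -- of walks ending outside `C`, and that number has expectation w times the escape probability
      -- of one walk.
      low≤escape : ∀ s → low s ≤ ι 2 * E (walkEnd ℓ s) (ind ∘ not ∘ lookup C)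
      low≤escape s = begin
        low s                                                   ≡⟨ trans (E-bind walks (pureD ∘ clipDecision) _) (E-cong walks λ ends → E-pure (clipDecision ends) (ind ∘ isLow)) ⟩
        E walks (ind ∘ isLow ∘ clipDecision)                    ≤⟨ replicate-mono (prob-walkEnd ℓ s) w (λ ends len → pointwise ends len (clipDecision ends) refl) ⟩
        E walks (λ ends → ι 2 * (+ 1 / w) * sumOver out ends)   ≡⟨ E-* walks (ι 2 * (+ 1 / w)) (sumOver out) ⟩
        ι 2 * (+ 1 / w) * E walks (sumOver out)                 ≡⟨ cong (ι 2 * (+ 1 / w) *_) (E-replicate-sumOver (prob-walkEnd ℓ s) w out) ⟩
        ι 2 * (+ 1 / w) * (ι w * E (walkEnd ℓ s) out)           ≡⟨ regroup (ι 2) (+ 1 / w) (ι w) (E (walkEnd ℓ s) out) ⟩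
        ι w * (+ 1 / w) * (ι 2 * E (walkEnd ℓ s) out)           ≡⟨ trans (cong (_* (ι 2 * E (walkEnd ℓ s) out)) (ι*1/ w)) (*-identityˡ _) ⟩
        ι 2 * E (walkEnd ℓ s) out                               ∎
        where
        open ≤-Reasoning
        walks = replicateD w (walkEnd ℓ s)
        out : Fin n → ℚ
        out = ind ∘ not ∘ lookup C
        regroup : ∀ a b c e → a * b * (c * e) ≡ c * b * (a * e)
        regroup = solve-∀ ℚ-ring
        0≤sumOver : ∀ ends → 0ℚ ≤ sumOver out ends
        0≤sumOver ends = subst (0ℚ ≤_) (ι-length-filterᵇ (not ∘ lookup C) ends) (0≤ι (outsideCount ends))
        pointwise : ∀ ends → length ends ≡ w → ∀ b → clipDecision ends ≡ b → ind (isLow b) ≤ ι 2 * (+ 1 / w) * sumOver out ends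
        pointwise ends len true  _  = 0≤* (0≤* (0≤ι 2) (0≤1/ w)) (0≤sumOver ends)
        pointwise ends len false eq = begin
          1ℚ                                          ≡⟨ ≡-sym (ι*1/ w) ⟩
          ι w * (+ 1 / w)                             ≤⟨ *-monoʳ (0≤1/ w) (ι-mono (clipDecision-low ends len eq)) ⟩
          ι (2 ℕ.* outsideCount ends) * (+ 1 / w)     ≡⟨ cong (_* (+ 1 / w)) (ι-* 2 (outsideCount ends)) ⟩
          ι 2 * ι (outsideCount ends) * (+ 1 / w)     ≡⟨ swap (ι 2) (ι (outsideCount ends)) (+ 1 / w) ⟩
          ι 2 * (+ 1 / w) * ι (outsideCount ends)     ≡⟨ cong (ι 2 * (+ 1 / w) *_) (ι-length-filterᵇ (not ∘ lookup C) ends) ⟩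
          ι 2 * (+ 1 / w) * sumOver out ends          ∎
          where
          swap : ∀ a b c → a * b * c ≡ a * c * b
          swap = solve-∀ ℚ-ring

    module _ (R : Subset n) (K : ℕ) (K-small : 3 ℕ.* K ℕ.≤ ℓ ^ 7)
      (R-small : 3 ℕ.* (ℓ ℕ.* suc ℓ) ℕ.* ∣ R ∣ ℕ.≤ n) (shattered : Shattered G ⊤ R K) where

      open Hitting (lookup R)

      -- A start in `R` counts as a hit at time 0, where the bound is trivial. Any other start has a
      -- piece to which the escape bound applies.
      low≤hit : ∀ s → low s ≤ ι 2 * hit ℓ s
      low≤hit s with s ∈? R
      ... | yes s∈R = begin
        low s              ≤⟨ E≤ (prob-EstClip s) (ind≤1 ∘ isLow) ⟩
        1ℚ                 ≤⟨ ι-mono {1} {2} (s≤s z≤n) ⟩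
        ι 2 * 1ℚ           ≡⟨ cong (ι 2 *_) (≡-sym (hit-ρ ℓ s ([]=⇒lookup s∈R))) ⟩
        ι 2 * hit ℓ s      ∎
        where open ≤-Reasoning
      ... | no s∉R =
        let (C , s∈C , _ , C≤K , C-closed) = shattered ∈⊤ s∉R in
        ≤-trans (low≤escape C (ℕₚ.≤-trans (ℕₚ.*-monoʳ-≤ 3 C≤K) K-small) s)
          (*-monoˡ (0≤ι 2) (escape≤hit (lookup C) (λ u∈C u~v → closed C C-closed (lookup⇒[]= _ C u∈C) u~v) ℓ s (inj₁ ([]=⇒lookup s∈C))))
        where
        closed : ∀ C → ClosedIn G ⊤ R C → ∀ {u v} → u ∈ C → adj G u v ≡ true → lookup C v ≡ true ⊎ lookup R v ≡ true
        closed C C-closed {v = v} u∈C u~v with v ∈? R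
        ... | yes v∈R = inj₂ ([]=⇒lookup v∈R)
        ... | no v∉R  = inj₁ ([]=⇒lookup (C-closed u∈C u~v ∈⊤ v∉R))

      averageLow : ℚ
      averageLow = E (uniform n) low

      averageLow-small : ι 3 * ι ℓ * averageLow ≤ ι 2
      averageLow-small = begin
        ι 3 * ι ℓ * averageLow                                            ≡⟨ cong (ι 3 * ι ℓ *_) (E-uniform n low) ⟩
        ι 3 * ι ℓ * ((+ 1 / n) * ∑ low)                                   ≤⟨ *-monoˡ (0≤* (0≤ι 3) (0≤ι ℓ)) (*-monoˡ (0≤1/ n) ∑low) ⟩
        ι 3 * ι ℓ * ((+ 1 / n) * (ι 2 * (ι (suc ℓ) * ι ∣ R ∣)))           ≡⟨ regroup (ι 3) (ι ℓ) (+ 1 / n) (ι 2) (ι (suc ℓ)) (ι ∣ R ∣) ⟩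
        ι 3 * (ι ℓ * ι (suc ℓ)) * ι ∣ R ∣ * ((+ 1 / n) * ι 2)             ≡⟨ cong (_* ((+ 1 / n) * ι 2)) (≡-sym casts) ⟩
        ι (3 ℕ.* (ℓ ℕ.* suc ℓ) ℕ.* ∣ R ∣) * ((+ 1 / n) * ι 2)             ≤⟨ *-monoʳ (0≤* (0≤1/ n) (0≤ι 2)) (ι-mono R-small) ⟩
        ι n * ((+ 1 / n) * ι 2)                                           ≡⟨ ≡-sym (*-assoc (ι n) (+ 1 / n) (ι 2)) ⟩
        ι n * (+ 1 / n) * ι 2                                             ≡⟨ trans (cong (_* ι 2) (ι*1/ n)) (*-identityˡ (ι 2)) ⟩
        ι 2                                                               ∎
        where
        open ≤-Reasoning
        regroup : ∀ a b c e f g → a * b * (c * (e * (f * g))) ≡ a * (b * f) * g * (c * e)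
        regroup = solve-∀ ℚ-ring
        casts : ι (3 ℕ.* (ℓ ℕ.* suc ℓ) ℕ.* ∣ R ∣) ≡ ι 3 * (ι ℓ * ι (suc ℓ)) * ι ∣ R ∣
        casts = trans (ι-* (3 ℕ.* (ℓ ℕ.* suc ℓ)) ∣ R ∣) (cong (_* ι ∣ R ∣)
          (trans (ι-* 3 (ℓ ℕ.* suc ℓ)) (cong (ι 3 *_) (ι-* ℓ (suc ℓ)))))
        ∑low : ∑ low ≤ ι 2 * (ι (suc ℓ) * ι ∣ R ∣)
        ∑low = begin
          ∑ low                                          ≤⟨ ∑-mono low≤hit ⟩
          ∑ (λ s → ι 2 * hit ℓ s)                        ≡⟨ ≡-sym (*-distribˡ-sum {n} (ι 2) (hit ℓ)) ⟩
          ι 2 * ∑ (hit ℓ)                                ≤⟨ *-monoˡ (0≤ι 2) (∑-hit ℓ) ⟩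
          ι 2 * (ι (suc ℓ) * ∑ (ind ∘ lookup R))         ≡⟨ cong (λ z → ι 2 * (ι (suc ℓ) * z)) (∑-ind R) ⟩
          ι 2 * (ι (suc ℓ) * ι ∣ R ∣)                    ∎

      E-countLow : E IsMinorFreeRun (ι ∘ countLow) ≡ ι (ℓ ^ 21) * averageLow
      E-countLow = begin
        E IsMinorFreeRun (ι ∘ countLow)
          ≡⟨ E-cong IsMinorFreeRun (ι-length-filterᵇ (isLow ∘ proj₁)) ⟩
        E IsMinorFreeRun (sumOver (ind ∘ isLow ∘ proj₁))
          ≡⟨ E-bind samples (mapD perVertex) (sumOver (ind ∘ isLow ∘ proj₁)) ⟩
        E samples (λ S → E (mapD perVertex S) (sumOver (ind ∘ isLow ∘ proj₁)))
          ≡⟨ E-cong samples (λ S → trans (E-mapD-sumOver prob-perVertex (ind ∘ isLow ∘ proj₁) S) (sumOver-cong low-perVertex S)) ⟩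
        E samples (sumOver low)
          ≡⟨ E-replicate-sumOver (prob-uniform n) (ℓ ^ 21) low ⟩
        ι (ℓ ^ 21) * averageLow ∎
        where
        open ≡-Reasoning
        samples = replicateD (ℓ ^ 21) (uniform n)

      fewLow : List (Bool × List (Fin n)) → Bool
      fewLow xs = countLow xs ℕ.≤ᵇ 2 ℕ.* ℓ ^ 20

      -- Markov's inequality as a lower bound: 1 - k/(2ℓ²⁰) is at most the indicator of k ≤ 2ℓ²⁰.
      -- The expected count is at most ℓ²¹ · 2/(3ℓ) = (2/3)ℓ²⁰, so the left side has expectation at
      -- least 1 - 1/3.
      fewLow-likely : + 2 / 3 ≤ weightOf IsMinorFreeRun fewLow
      fewLow-likely = begin
        + 2 / 3                                                        ≡⟨⟩
        1ℚ + - third                                                   ≤⟨ +-monoʳ-≤ 1ℚ (neg-antimono-≤ expected≤third) ⟩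
        1ℚ + - (c * (ι (ℓ ^ 21) * averageLow))                         ≡⟨ cong (λ z → 1ℚ + - (c * z)) (≡-sym E-countLow) ⟩
        1ℚ + - (c * E IsMinorFreeRun (ι ∘ countLow))                   ≡⟨ cong₂ _+_ (≡-sym (mass prob-run)) (trans (neg-distribˡ-* c _) (≡-sym (E-* IsMinorFreeRun (- c) (ι ∘ countLow)))) ⟩
        E IsMinorFreeRun (λ _ → 1ℚ) + E IsMinorFreeRun (λ xs → - c * ι (countLow xs))
                                                                       ≡⟨ ≡-sym (E-+ IsMinorFreeRun (λ _ → 1ℚ) (λ xs → - c * ι (countLow xs))) ⟩
        E IsMinorFreeRun (λ xs → 1ℚ + - c * ι (countLow xs))           ≤⟨ mono prob-run (λ xs → markov (countLow xs) (fewLow xs) refl) ⟩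
        E IsMinorFreeRun (ind ∘ fewLow)                                ≡⟨ ≡-sym (weightOf≡E IsMinorFreeRun fewLow) ⟩
        weightOf IsMinorFreeRun fewLow                                 ∎
        where
        open ≤-Reasoning
        third = + 1 / 3
        L = ℓ ^ 20
        instance
          2L≢0 : NonZero (2 ℕ.* L)
          2L≢0 = ℕₚ.m*n≢0 2 L {{_}} {{ℕₚ.m^n≢0 ℓ 20}}
        c = + 1 / (2 ℕ.* L)
        0≤c : 0ℚ ≤ c
        0≤c = 0≤1/ (2 ℕ.* L)
        regroup : ∀ t x c u v q → t * x * (c * (u * v * q)) ≡ t * (c * v * (x * u * q))
        regroup = solve-∀ ℚ-ring
        swap : ∀ c v t → c * v * t ≡ t * v * c
        swap = solve-∀ ℚ-ring
        expected≤third : c * (ι (ℓ ^ 21) * averageLow) ≤ third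
        expected≤third = begin
          c * (ι (ℓ ^ 21) * averageLow)                      ≡⟨ cong (λ z → c * (z * averageLow)) (ι-* ℓ L) ⟩
          -- The product `third * ι 3` evaluates to `1ℚ`, so the unit law inserts the factor 3 that
          -- `averageLow-small` expects.
          c * (ι ℓ * ι L * averageLow)                       ≡⟨ ≡-sym (*-identityˡ _) ⟩
          third * ι 3 * (c * (ι ℓ * ι L * averageLow))       ≡⟨ regroup third (ι 3) c (ι ℓ) (ι L) averageLow ⟩
          third * (c * ι L * (ι 3 * ι ℓ * averageLow))       ≤⟨ *-monoˡ (0≤1/ 3) (*-monoˡ (0≤* 0≤c (0≤ι L)) averageLow-small) ⟩
          third * (c * ι L * ι 2)                            ≡⟨ cong (third *_) (trans (swap c (ι L) (ι 2)) (trans (cong (_* c) (≡-sym (ι-* 2 L))) (ι*1/ (2 ℕ.* L)))) ⟩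
          third * 1ℚ                                         ≡⟨⟩
          third                                              ∎
        negated : ∀ x → - c * x ≡ - (c * x)
        negated x = ≡-sym (neg-distribˡ-* c x)
        markov : ∀ k b → (k ℕ.≤ᵇ 2 ℕ.* L) ≡ b → 1ℚ + - c * ι k ≤ ind b
        markov k true _ = begin
          1ℚ + - c * ι k       ≡⟨ cong (λ z → 1ℚ + z) (negated (ι k)) ⟩
          1ℚ + - (c * ι k)     ≤⟨ +-monoʳ-≤ 1ℚ (neg-antimono-≤ (0≤* 0≤c (0≤ι k))) ⟩
          1ℚ + - 0ℚ            ≡⟨⟩
          1ℚ                   ∎
        markov k false eq = begin
          1ℚ + - c * ι k       ≡⟨ cong (λ z → 1ℚ + z) (negated (ι k)) ⟩
          1ℚ + - (c * ι k)     ≤⟨ +-monoʳ-≤ 1ℚ (neg-antimono-≤ 1≤ck) ⟩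
          1ℚ + - 1ℚ            ≡⟨⟩
          0ℚ                   ∎
          where
          2L≤k : 2 ℕ.* L ℕ.≤ k
          2L≤k = ℕₚ.≰⇒≥ λ k≤ → contradiction (trans (≡-sym eq) (Equivalence.to T-≡ (ℕₚ.≤⇒≤ᵇ k≤))) λ ()
          1≤ck : 1ℚ ≤ c * ι k
          1≤ck = begin
            1ℚ                      ≡⟨ ≡-sym (ι*1/ (2 ℕ.* L)) ⟩
            ι (2 ℕ.* L) * c         ≡⟨ *-comm _ c ⟩
            c * ι (2 ℕ.* L)         ≤⟨ *-monoˡ 0≤c (ι-mono 2L≤k) ⟩
            c * ι k                 ∎

      -- The Boolean sub-event need not test for minors: forgetting the confinement to the visited
      -- set turns a found minor into a minor of G, so that condition holds for every outcome and
      -- `fewLow` decides alone.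
      accepts-likely : ∀ {r} {H : Graph r} → MinorFree G H → PrAtLeast IsMinorFreeRun (Accepts H) (+ 2 / 3)
      accepts-likely {H = H} minorFree = fewLow
        , (λ xs few → All.universal (λ _ (β , _ , minor) → minorFree (β , (λ _ _ _ → tt) , minor)) xs
                    , ℕₚ.≤ᵇ⇒≤ (countLow xs) (2 ℕ.* ℓ ^ 20) (Equivalence.from T-≡ few))
        , fewLow-likely

-- Assembly with α = 48

open import Data.Nat using (ℕ; _≤_; NonZero; _*_; _^_; s≤s; z≤n)
open import Data.Rational using (ℚ; 0ℚ; ½; _<_; _/_) renaming (_≤_ to _≤ℚ_)
open import Data.Integer using (+_)
open import Data.Product using (∃-syntax; _,_)
open import Data.Nat.Properties using (≤-trans; m≤m+n; m^n>0)
open import Data.Fin.Subset using (∣_∣)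

accepts-likely : ∀ {r ℓ n d} (H : Graph r) → 3 ≤ r → 48 * r ^ 3 ≤ ℓ → .{{_ : NonZero n}} → .{{_ : NonZero d}} →
  (G : Graph n) → MaxDegree≤ G d → MinorFree G H →
  PrAtLeast (Walk.Alg.IsMinorFreeRun G d ℓ) (Walk.Alg.Accepts G d ℓ H) ((+ 2) / 3)
accepts-likely {r} {ℓ} {n} {d} H r≥3 ℓ-large G maxDegree minorFree =
  -- The scale q = ℓ³ meets two opposing demands: pieces of q² = ℓ⁶ vertices must stay below ℓ⁷/3
  -- for the clipping threshold, and the deleted fraction 8r²/q must be at most 1/(3ℓ(ℓ + 1)).
  let (R , size , shattered) = Hyperfiniteness.hyperfinite G {H = H} minorFree r>0 (ℓ ^ 3) (m^n>0 ℓ 3)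
  in Acceptance.Run.accepts-likely G d maxDegree ℓ R (ℓ ^ 3 * ℓ ^ 3) K-small (R-small ∣ R ∣ n size) shattered {H = H} minorFree
  where
  r>0 = ≤-trans (s≤s z≤n) r≥3
  open Hyperfiniteness.Bounds r ℓ r>0 ℓ-large

theorem2p1 : ∃[ α ] ∀ (r : ℕ) → 3 ≤ r → (H : Graph r) →
    (ε : ℚ) → (ε>0 : 0ℚ < ε) → ε ≤ℚ ½ →
    (n : ℕ) → .{{_ : NonZero n}} → (d : ℕ) → .{{_ : NonZero d}} →
    (G : Graph n) → MaxDegree≤ G d → MinorFree G H →
    PrAtLeast (Walk.Alg.IsMinorFreeRun G d (ellParam α r ε ε>0))
    (Walk.Alg.Accepts G d (ellParam α r ε ε>0) H)
    ((+ 2) / 3)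
theorem2p1 = 48 , λ r r≥3 H ε ε>0 _ n d G maxDegree minorFree →
  accepts-likely H r≥3 (m≤m+n (48 * r ^ 3) _) G maxDegree minorFree
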